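{- Let $k$ be constant (with $2\le s\le k$). Assume that any randomized algorithm for PARITY-$(k,s)$-CLIQUE with error probability less than $1/3$ takes time at least $n^{\Omega(k)}$ in the worst case for hypergraphs on $n$ vertices. Then there is a small enough constant $\epsilon=\epsilon(k,s)>0$ such that if an algorithm $A$ for PARITY-$(k,s)$-CLIQUE has error probability less than $\epsilon$ on $G(n,1/2,s)$, then $A$ must have runtime $T(A,n)\ge n^{\Omega(k)}$.
   Context: An $s$-uniform hypergraph $G=(V(G),E(G))$ has hyperedge set $E(G)\subseteq\binom{V(G)}{s}$. A $k$-clique is a set $S\subset V(G)$ with $|S|=k$ and $\binom{S}{s}\subseteq E(G)$. PARITY-$(k,s)$-CLIQUE is the problem of computing the parity of the number of $k$-cliques of a given $s$-uniform hypergraph. $G(n,1/2,s)$ is the Erdős–Rényi distribution on $s$-uniform hypergraphs on $n$ vertices, in which each of the $\binom{n}{s}$ possible hyperedges is included independently with probability $1/2$. All algorithms are randomized, and each (possibly biased) coin flip has constant cost. $T(A,n)$ denotes the worst-case runtime of $A$ on $n$-vertex hypergraphs, assumed non-decreasing in $n$. Error probability on a distribution is over both the random input and the algorithm's random bits; worst-case error probability is over the algorithm's random bits only. -}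

module Defs where

open import Data.Bool.Base using (Bool; true; false; if_then_else_; not; _∨_; T)
open import Data.Bool.Properties using (T?) renaming (_≟_ to _≟ᵇ_)
open import Data.Fin.Subset using (Subset; inside; outside; _⊆_; ∣_∣)
open import Data.Fin.Subset.Properties using (_⊆?_)
open import Data.Integer.Base using (+_)
open import Data.List.Base as List using (List; []; _∷_; _++_; foldr; length; filter)
import Data.List.Properties as List
open import Data.List.Membership.Propositional using (_∈_)
open import Data.List.Membership.Propositional.Properties
  using (∈-map⁺; ∈-++⁺ˡ; ∈-++⁺ʳ)
import Data.List.Relation.Unary.All as All
open import Data.List.Relation.Unary.Any using (here; any?)
open import Data.Nat.Base
  using (ℕ; zero; suc; _+_; _*_; _∸_; _^_; _≤_; _/_; _%_; _<ᵇ_; _≡ᵇ_; NonZero)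
open import Data.Nat.Properties using (_≟_; m^n≢0)
open import Data.Product.Base using (Σ-syntax; ∃-syntax; _×_; _,_; proj₁; proj₂)
import Data.Rational.Base as ℚ
open ℚ using (ℚ; 0ℚ; 1ℚ)
open import Data.Vec.Base as Vec using ([]; _∷_)
import Data.Vec.Properties as Vec
open import Relation.Binary.PropositionalEquality using (_≡_; refl; cong)
open import Relation.Nullary.Decidable using (Dec; does; map′; _×-dec_; _→-dec_)

private
  variable
    A B : Set

------------------------------------------------------------------------
-- Finite probability distributions

-- `coin a b x y` continues as x with probability (a+1)/(a+b+2) and as y
-- with probability (b+1)/(a+b+2).  Every rational bias strictly between 0
-- and 1 arises, so every leaf has positive probability.
data Dist (A : Set) : Set where
  pure : A → Dist A
  coin : (a b : ℕ) → Dist A → Dist A → Dist A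

infixl 1 _>>=_

_>>=_ : Dist A → (A → Dist B) → Dist B
pure x       >>= f = f x
coin a b x y >>= f = coin a b (x >>= f) (y >>= f)

mapDist : (A → B) → Dist A → Dist B
mapDist f d = d >>= λ x → pure (f x)

fairCoin : Dist A → Dist A → Dist A
fairCoin = coin 0 0

bias : ℕ → ℕ → ℚ
bias a b = (+ suc a) ℚ./ (suc a + suc b)

Pr : Dist Bool → ℚ
Pr (pure e)       = if e then 1ℚ else 0ℚ
Pr (coin a b x y) = bias a b ℚ.* Pr x ℚ.+ bias b a ℚ.* Pr y

Always : (A → Set) → Dist A → Set
Always P (pure x)       = P x
Always P (coin _ _ x y) = Always P x × Always P y

------------------------------------------------------------------------
-- Uniform hypergraphs and cliques

-- The k-element subsets of {0, …, n-1}.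
Choose : ℕ → ℕ → Set
Choose n k = Σ[ S ∈ Subset n ] ∣ S ∣ ≡ k

choose : ∀ n k → List (Choose n k)
choose zero    zero    = ([] , refl) ∷ []
choose zero    (suc k) = []
choose (suc n) zero    =
  List.map (λ (S , p) → outside ∷ S , p) (choose n zero)
choose (suc n) (suc k) =
  List.map (λ (S , p) → inside ∷ S , cong suc p) (choose n k) ++
  List.map (λ (S , p) → outside ∷ S , p) (choose n (suc k))

∈-choose : ∀ {n k} (S : Choose n k) → S ∈ choose n k
∈-choose {zero}  {zero}  ([] , refl)          = here refl
∈-choose {suc n} {zero}  (outside ∷ S , p)    =
  ∈-map⁺ (λ (S , p) → outside ∷ S , p) (∈-choose (S , p))
∈-choose {suc n} {suc k} (inside ∷ S , refl)  =
  ∈-++⁺ˡ (∈-map⁺ (λ (S , p) → inside ∷ S , cong suc p) (∈-choose (S , refl)))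
∈-choose {suc n} {suc k} (outside ∷ S , p)    =
  ∈-++⁺ʳ (List.map (λ (S , p) → inside ∷ S , cong suc p) (choose n k))
    (∈-map⁺ (λ (S , p) → outside ∷ S , p) (∈-choose (S , p)))

-- The characteristic function of the hyperedge set.
Hypergraph : ℕ → ℕ → Set
Hypergraph n s = Choose n s → Bool

IsClique : ∀ {n s k} → Hypergraph n s → Choose n k → Set
IsClique {n} {s} G (S , _) = ∀ (e : Choose n s) → proj₁ e ⊆ S → T (G e)

isClique? : ∀ {n s k} (G : Hypergraph n s) (S : Choose n k) → Dec (IsClique G S)
isClique? {n} {s} G (S , _) =
  map′ (λ all e → All.lookup all (∈-choose e)) (λ f → All.tabulate (λ {e} _ → f e))
    (All.all? (λ e → (proj₁ e ⊆? S) →-dec T? (G e)) (choose n s))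

numCliques : ∀ {n s} → ℕ → Hypergraph n s → ℕ
numCliques {n} k G = length (filter (isClique? G) (choose n k))

cliqueParity : ∀ {n s} → ℕ → Hypergraph n s → ℕ
cliqueParity k G = numCliques k G % 2

insertEdge : ∀ {n s} → Choose n s → Hypergraph n s → Hypergraph n s
insertEdge (e , _) G e′ = does (Vec.≡-dec _≟ᵇ_ e (proj₁ e′)) ∨ G e′

-- G(n, 1/2, s): one independent fair coin for each possible hyperedge.
randomHypergraph : ∀ n s → Dist (Hypergraph n s)
randomHypergraph n s = foldr addEdge (pure (λ _ → false)) (choose n s)
  where
  addEdge : Choose n s → Dist (Hypergraph n s) → Dist (Hypergraph n s)
  addEdge e D = D >>= λ G → fairCoin (pure (insertEdge e G)) (pure G)

------------------------------------------------------------------------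
-- Randomized word-RAM programs

-- The memory consists of arrays, named by natural numbers, whose cells hold
-- words and are addressed by tuples of words.  A program mentions only
-- finitely many arrays and tuple lengths.

data Op : Set where
  add sub mul quo rem lt eq : Op

data Expr : Set where
  lit  : ℕ → Expr
  read : ℕ → List Expr → Expr
  op   : Op → Expr → Expr → Expr

data Stmt : Set where
  assign : ℕ → List Expr → Expr → Stmt
  flip   : ℕ → List Expr → Expr → Expr → Stmt
  ifElse : Expr → List Stmt → List Stmt → Stmt
  while  : Expr → List Stmt → Stmt

Code : Set
Code = List Stmt

Memory : Set
Memory = ℕ → List ℕ → ℕ

write : ℕ → List ℕ → ℕ → Memory → Memory
write a is v σ b js =
  if does ((a ≟ b) ×-dec List.≡-dec _≟_ is js) then v else σ b js

-- Truncated subtraction; division and remainder by zero give zero.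
⟦_⟧ : Op → ℕ → ℕ → ℕ
⟦ add ⟧ x y       = x + y
⟦ sub ⟧ x y       = x ∸ y
⟦ mul ⟧ x y       = x * y
⟦ quo ⟧ x zero    = 0
⟦ quo ⟧ x (suc y) = x / suc y
⟦ rem ⟧ x zero    = 0
⟦ rem ⟧ x (suc y) = x % suc y
⟦ lt  ⟧ x y       = if x <ᵇ y then 1 else 0
⟦ eq  ⟧ x y       = if x ≡ᵇ y then 1 else 0

-- Words are the naturals below W; all arithmetic is modulo W.
module WordRAM (W : ℕ) .{{_ : NonZero W}} where

  mutual
    eval : Memory → Expr → ℕ
    eval σ (lit c)     = c % W
    eval σ (read a es) = σ a (evals σ es)
    eval σ (op o d e)  = ⟦ o ⟧ (eval σ d) (eval σ e) % W

    evals : Memory → List Expr → List ℕ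
    evals σ []       = []
    evals σ (e ∷ es) = eval σ e ∷ evals σ es

  -- The statements still to be executed, and the memory.
  Config : Set
  Config = Code × Memory

  step : Stmt → Code → Memory → Dist Config
  step (assign a es e)  K σ = pure (K , write a (evals σ es) (eval σ e) σ)
  step (flip a es d e)  K σ =
    coin (eval σ d) (eval σ e)
      (pure (K , write a (evals σ es) 1 σ))
      (pure (K , write a (evals σ es) 0 σ))
  step (ifElse e P Q)   K σ with eval σ e
  ... | zero  = pure (Q ++ K , σ)
  ... | suc _ = pure (P ++ K , σ)
  step (while e P)      K σ with eval σ e
  ... | zero  = pure (K , σ)
  ... | suc _ = pure (P ++ while e P ∷ K , σ)

  -- Every step, including every coin flip, costs one unit of time; a
  -- statement evaluates a number of operations that depends only on the code.
  run : ℕ → Config → Dist Config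
  run t       ([] , σ)    = pure ([] , σ)
  run zero    (S ∷ K , σ) = pure (S ∷ K , σ)
  run (suc t) (S ∷ K , σ) = step S K σ >>= run t

  HaltsWithin : ℕ → Config → Set
  HaltsWithin t c = Always (λ (K , _) → K ≡ []) (run t c)

sizeArray inputArray outputArray : ℕ
sizeArray   = 0
inputArray  = 1
outputArray = 2

elements : ∀ {n} → Subset n → List ℕ
elements []            = []
elements (inside ∷ S)  = 0 ∷ List.map suc (elements S)
elements (outside ∷ S) = List.map suc (elements S)

-- The cell addressed by v₁ < … < vₛ of the input array tells whether
-- {v₁, …, vₛ} is a hyperedge.
encode : ∀ {n s} → Hypergraph n s → List ℕ → ℕ
encode {n} {s} G vs =
  if does (any? (λ e → List.≡-dec _≟_ (elements (proj₁ e)) vs ×-dec T? (G e)) (choose n s))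
  then 1 else 0

initialMemory : ∀ {n s} → Hypergraph n s → Memory
initialMemory {n} G 0 [] = n
initialMemory     G 1 vs = encode G vs
initialMemory     G _ _  = 0

-- On n-vertex inputs, words range over {0, …, (n+2)^(κ+1) - 1}, that is, they
-- have Θ(log n) bits.
wordBound : ℕ → ℕ → ℕ
wordBound κ n = (2 + n) ^ suc κ

module Machine (κ n : ℕ) =
  WordRAM (wordBound κ n) {{m^n≢0 (2 + n) (suc κ)}}

-- A uniform randomized algorithm on s-uniform hypergraphs, together with a
-- non-decreasing bound on its running time that is valid for all inputs and
-- all outcomes of the coin flips.
record Algorithm (s : ℕ) : Set where
  field
    code      : Code
    κ         : ℕ
    time      : ℕ → ℕ
    time-mono : ∀ {m n} → m ≤ n → time m ≤ time n

  start : ∀ {n} → Hypergraph n s → Code × Memory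
  start G = code , initialMemory G

  field
    halts : ∀ n (G : Hypergraph n s) →
            Machine.HaltsWithin κ n (time n) (start G)

  output : ∀ n → Hypergraph n s → Dist ℕ
  output n G =
    mapDist (λ (_ , σ) → σ outputArray [])
      (Machine.run κ n (time n) (start G))

open Algorithm public using (time)

errs : ∀ {s} → ℕ → Algorithm s → ∀ n → Hypergraph n s → Dist Bool
errs k A n G =
  mapDist (λ out → not (out ≡ᵇ cliqueParity k G)) (Algorithm.output A n G)

worstCaseErrorBelow : ∀ {s} → ℚ → ℕ → Algorithm s → Set
worstCaseErrorBelow {s} δ k A =
  ∀ n (G : Hypergraph n s) → Pr (errs k A n G) ℚ.< δ

averageErrorBelow : ∀ {s} → ℚ → ℕ → Algorithm s → Set
averageErrorBelow {s} δ k A =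
  ∀ n → Pr (randomHypergraph n s >>= errs k A n) ℚ.< δ

-- f(n) = Ω(n^{(a/b)·k}), that is, n^{(a/b)·k} ≤ C·f(n) for all large n, with
-- both sides raised to the b-th power.
LowerBound : ℕ → ℕ → ℕ → (ℕ → ℕ) → Set
LowerBound a b k f =
  ∃[ C ] ∃[ n₀ ] (∀ n → n₀ ≤ n → n ^ (a * k) ≤ (C * f n) ^ b)

{-# OPTIONS --safe #-}
module Submission where

-- Over 𝔽₂ the parity f of the number of k-cliques is a polynomial in the
-- hyperedge indicators, of degree less than D = 2^k + 1 whatever n is, so its
-- D-fold derivatives vanish: f(G) is the sum of f(G + Σ_{i∈U} rᵢ) over the
-- nonempty U ⊆ {1, …, D}, for any r₁, …, r_D.  If the rᵢ are uniform, then so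
-- is each of the J = 2^D − 1 queries G + Σ_{i∈U} rᵢ, and adding up the answers
-- of A to the queries errs with probability at most J·ε, where ε = 1/(3(J+1)).
-- Writing down the queries would cost time of order n^s, which might exceed
-- the running time of A.  The rᵢ are therefore sampled lazily: the bits of a
-- cell are drawn when some run of A first accesses it, so that each step of A
-- is simulated in constant time.  The remaining constant overhead is absorbed
-- because A takes at least one step.

open import Defs
open import Algebra.Bundles using (module CommutativeMonoid)
open import Data.Bool.Base using (Bool; true; false; if_then_else_; not; _∧_; _∨_; _xor_; T)
open import Data.Bool.Properties
  using (T?; not-involutive; xor-assoc; xor-comm; xor-identityʳ; xor-same; ∧-zeroʳ; ∨-zeroʳ)
  renaming (_≟_ to _≟ᵇ_)
open import Data.Fin.Base using (Fin; zero; suc)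
import Data.Fin.Properties as Fin
open import Data.Fin.Subset using (Subset; inside; outside; _⊆_; ∣_∣)
open import Data.Fin.Subset.Properties using (_⊆?_; drop-∷-⊆; ∣p∣≤∣x∷p∣)
open import Data.Integer.Base as ℤ using (+_)
import Data.Integer.Properties as ℤ
open import Data.List.Base as List using (List; []; _∷_; _++_; length; filter; foldr)
import Data.List.Properties as List
open import Data.List.Membership.Propositional using (_∈_)
open import Data.List.Membership.Propositional.Properties using (∈-lookup; ∈-map⁻)
open import Data.List.Relation.Unary.All as All using (All; []; _∷_)
import Data.List.Relation.Unary.All.Properties as All
open import Data.List.Relation.Unary.AllPairs using ([]; _∷_)
open import Data.List.Relation.Unary.Any as Any using (any?; index)
open import Data.List.Relation.Unary.Any.Properties using (lookup-index)
open import Data.List.Relation.Unary.Unique.Propositional using (Unique)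
import Data.List.Relation.Unary.Unique.Propositional.Properties as Unique
open import Data.Maybe.Base using (Maybe; just; nothing; maybe′; is-just)
open import Data.Nat.Base as ℕ
  using (ℕ; zero; suc; NonZero; z≤n; s≤s; _<ᵇ_; _≡ᵇ_; _+_; _*_; _^_; _%_; _≤_)
open import Data.Nat.DivMod using (%-distribˡ-+; m<n⇒m%n≡m)
import Data.Nat.Properties as ℕ
open import Data.Product.Base using (Σ-syntax; ∃-syntax; _×_; _,_; proj₁; proj₂)
open import Data.Rational.Base as ℚ using (ℚ; 0ℚ; 1ℚ; _<_; _/_; toℚᵘ; NonNegative)
import Data.Rational.Properties as ℚ
import Data.Rational.Unnormalised.Base as ℚᵘ
import Data.Rational.Unnormalised.Properties as ℚᵘ
open import Data.Sum.Base using (_⊎_; inj₁; inj₂)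
open import Data.Unit.Base using (⊤; tt)
open import Data.Vec.Base as Vec
  using (Vec; []; _∷_; here; lookup; replicate; zipWith; _[_]≔_)
import Data.Vec.Properties as Vec
open import Function.Base using (_∘_; id)
open import Relation.Binary.PropositionalEquality
open import Relation.Nullary.Decidable
  using (Dec; does; yes; no; _×-dec_; _→-dec_; dec-true; dec-false)
open import Relation.Nullary.Negation using (¬_; contradiction)

-- Expectations over finite distributions

-- The union bound uses only the law of each single query, so the strong dependence between the
-- queries is harmless. Working over 𝔽₂ makes each query distributed exactly as G(n,1/2,s), rather
-- than as a point over a larger field that would have to be encoded in bits. The conclusion keeps
-- the exponent `a / b` of the hypothesis, so the overhead has to be a constant factor. This is why
-- the code of A is translated statement by statement, and why the analysis is one of deferred
-- decisions: every state carries an expectation over all completions of the partly sampled table, a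
-- simulated run is compared with A on a memory filled in from a completion, and drawing a cell does
-- not change the expectation. A takes at least one step because otherwise its code is empty and it
-- answers 0 on every input. The complete hypergraph on k vertices has exactly one k-clique, so
-- correcting such an A there would force the errors on the queries to add up to at least 1.

private
  variable
    A B : Set

toℚᵘ-/ : ∀ i n .{{_ : NonZero n}} → toℚᵘ (i / n) ℚᵘ.≃ (i ℚᵘ./ n)
toℚᵘ-/ i (suc n) = ℚ.toℚᵘ-fromℚᵘ (ℚᵘ.mkℚᵘ i n)

/-+ : ∀ i j n .{{_ : NonZero n}} → i / n ℚ.+ j / n ≡ (i ℤ.+ j) / n
/-+ i j n@(suc _) = ℚ.toℚᵘ-injective (begin
  toℚᵘ (i / n ℚ.+ j / n)              ≈⟨ ℚ.toℚᵘ-homo-+ (i / n) (j / n) ⟩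
  toℚᵘ (i / n) ℚᵘ.+ toℚᵘ (j / n)    ≈⟨ ℚᵘ.+-cong (toℚᵘ-/ i n) (toℚᵘ-/ j n) ⟩
  i ℚᵘ./ n ℚᵘ.+ j ℚᵘ./ n            ≈⟨ ℚᵘ.*≡* pf ⟩
  (i ℤ.+ j) ℚᵘ./ n                  ≈⟨ toℚᵘ-/ (i ℤ.+ j) n ⟨
  toℚᵘ ((i ℤ.+ j) / n)              ∎)
  where
  open ℚᵘ.≃-Reasoning
  pf : (i ℤ.* + n ℤ.+ j ℤ.* + n) ℤ.* + n ≡ (i ℤ.+ j) ℤ.* (+ n ℤ.* + n)
  pf = trans (cong (ℤ._* + n) (sym (ℤ.*-distribʳ-+ (+ n) i j))) (ℤ.*-assoc (i ℤ.+ j) (+ n) (+ n))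

n/n≡1 : ∀ n .{{_ : NonZero n}} → + n / n ≡ 1ℚ
n/n≡1 n@(suc _) = ℚ.toℚᵘ-injective
  (ℚᵘ.≃-trans (toℚᵘ-/ (+ n) n) (ℚᵘ.*≡* (ℤ.*-comm (+ n) (+ 1))))

bias-sum : ∀ a b → bias a b ℚ.+ bias b a ≡ 1ℚ
bias-sum a b = begin
  bias a b ℚ.+ + suc b / (suc b ℕ.+ suc a)
    ≡⟨ cong (λ q → bias a b ℚ.+ q) (ℚ./-cong {+ suc b} refl (ℕ.+-comm (suc b) (suc a))) ⟩
  + suc a / n ℚ.+ + suc b / n          ≡⟨ /-+ (+ suc a) (+ suc b) n ⟩
  + n / n                            ≡⟨ n/n≡1 n ⟩
  1ℚ                                 ∎
  where
  open ≡-Reasoning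
  n : ℕ
  n = suc a ℕ.+ suc b

bias-nonNeg : ∀ a b → NonNegative (bias a b)
bias-nonNeg a b = ℚ.normalize-nonNeg (suc a) (suc a ℕ.+ suc b)

𝔼 : Dist A → (A → ℚ) → ℚ
𝔼 (pure x)       h = h x
𝔼 (coin a b x y) h = bias a b ℚ.* 𝔼 x h ℚ.+ bias b a ℚ.* 𝔼 y h

𝟙 : Bool → ℚ
𝟙 b = if b then 1ℚ else 0ℚ

Pr≡𝔼 : ∀ d → Pr d ≡ 𝔼 d 𝟙
Pr≡𝔼 (pure x)       = refl
Pr≡𝔼 (coin a b x y) = cong₂ (λ p q → bias a b ℚ.* p ℚ.+ bias b a ℚ.* q) (Pr≡𝔼 x) (Pr≡𝔼 y)

𝔼->>= : ∀ (d : Dist A) (f : A → Dist B) h → 𝔼 (d >>= f) h ≡ 𝔼 d (λ x → 𝔼 (f x) h)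
𝔼->>= (pure x)       f h = refl
𝔼->>= (coin a b x y) f h =
  cong₂ (λ p q → bias a b ℚ.* p ℚ.+ bias b a ℚ.* q) (𝔼->>= x f h) (𝔼->>= y f h)

𝔼-cong : ∀ (d : Dist A) {g h : A → ℚ} → (∀ x → g x ≡ h x) → 𝔼 d g ≡ 𝔼 d h
𝔼-cong (pure x)       pf = pf x
𝔼-cong (coin a b x y) pf =
  cong₂ (λ p q → bias a b ℚ.* p ℚ.+ bias b a ℚ.* q) (𝔼-cong x pf) (𝔼-cong y pf)

𝔼-congᴬ : ∀ {P : A → Set} (d : Dist A) → Always P d → {g h : A → ℚ} →
          (∀ x → P x → g x ≡ h x) → 𝔼 d g ≡ 𝔼 d h
𝔼-congᴬ (pure x)       p       pf = pf x p
𝔼-congᴬ (coin a b x y) (p , q) pf =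
  cong₂ (λ p q → bias a b ℚ.* p ℚ.+ bias b a ℚ.* q) (𝔼-congᴬ x p pf) (𝔼-congᴬ y q pf)

mix-mono : ∀ a b {p p′ q q′} → p ℚ.≤ p′ → q ℚ.≤ q′ →
           bias a b ℚ.* p ℚ.+ bias b a ℚ.* q ℚ.≤ bias a b ℚ.* p′ ℚ.+ bias b a ℚ.* q′
mix-mono a b p≤p′ q≤q′ = ℚ.+-mono-≤
  (ℚ.*-monoˡ-≤-nonNeg (bias a b) {{bias-nonNeg a b}} p≤p′)
  (ℚ.*-monoˡ-≤-nonNeg (bias b a) {{bias-nonNeg b a}} q≤q′)

𝔼-mono : ∀ (d : Dist A) {g h : A → ℚ} → (∀ x → g x ℚ.≤ h x) → 𝔼 d g ℚ.≤ 𝔼 d h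
𝔼-mono (pure x)       le = le x
𝔼-mono (coin a b x y) le = mix-mono a b (𝔼-mono x le) (𝔼-mono y le)

𝔼-monoᴬ : ∀ {P : A → Set} (d : Dist A) → Always P d → {g h : A → ℚ} →
          (∀ x → P x → g x ℚ.≤ h x) → 𝔼 d g ℚ.≤ 𝔼 d h
𝔼-monoᴬ (pure x)       p       le = le x p
𝔼-monoᴬ (coin a b x y) (p , q) le = mix-mono a b (𝔼-monoᴬ x p le) (𝔼-monoᴬ y q le)

mix-const : ∀ a b q → bias a b ℚ.* q ℚ.+ bias b a ℚ.* q ≡ q
mix-const a b q = begin
  bias a b ℚ.* q ℚ.+ bias b a ℚ.* q   ≡⟨ ℚ.*-distribʳ-+ q (bias a b) (bias b a) ⟨
  (bias a b ℚ.+ bias b a) ℚ.* q     ≡⟨ cong (ℚ._* q) (bias-sum a b) ⟩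
  1ℚ ℚ.* q                        ≡⟨ ℚ.*-identityˡ q ⟩
  q                             ∎
  where open ≡-Reasoning

𝔼-const : ∀ (d : Dist A) q → 𝔼 d (λ _ → q) ≡ q
𝔼-const (pure x)       q = refl
𝔼-const (coin a b x y) q =
  trans (cong₂ (λ u v → bias a b ℚ.* u ℚ.+ bias b a ℚ.* v) (𝔼-const x q) (𝔼-const y q))
        (mix-const a b q)

mix-+ : ∀ p q u v u′ v′ → p ℚ.* (u ℚ.+ u′) ℚ.+ q ℚ.* (v ℚ.+ v′) ≡ (p ℚ.* u ℚ.+ q ℚ.* v) ℚ.+ (p ℚ.* u′ ℚ.+ q ℚ.* v′)
mix-+ p q u v u′ v′ = trans (cong₂ ℚ._+_ (ℚ.*-distribˡ-+ p u u′) (ℚ.*-distribˡ-+ q v v′))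
  (interchange (p ℚ.* u) (p ℚ.* u′) (q ℚ.* v) (q ℚ.* v′))
  where open import Algebra.Properties.CommutativeSemigroup
          (CommutativeMonoid.commutativeSemigroup ℚ.+-0-commutativeMonoid) using (interchange)

𝔼-+ : ∀ (d : Dist A) (g h : A → ℚ) → 𝔼 d (λ x → g x ℚ.+ h x) ≡ 𝔼 d g ℚ.+ 𝔼 d h
𝔼-+ (pure x)       g h = refl
𝔼-+ (coin a b x y) g h =
  trans (cong₂ (λ p q → bias a b ℚ.* p ℚ.+ bias b a ℚ.* q) (𝔼-+ x g h) (𝔼-+ y g h))
        (mix-+ (bias a b) (bias b a) (𝔼 x g) (𝔼 y g) (𝔼 x h) (𝔼 y h))

𝔼-*ˡ : ∀ (d : Dist A) c (h : A → ℚ) → 𝔼 d (λ x → c ℚ.* h x) ≡ c ℚ.* 𝔼 d h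
𝔼-*ˡ (pure x)       c h = refl
𝔼-*ˡ (coin a b x y) c h =
  trans (cong₂ (λ p q → bias a b ℚ.* p ℚ.+ bias b a ℚ.* q) (𝔼-*ˡ x c h) (𝔼-*ˡ y c h))
        (trans (cong₂ ℚ._+_ (x∙yz≈y∙xz (bias a b) c (𝔼 x h)) (x∙yz≈y∙xz (bias b a) c (𝔼 y h)))
               (sym (ℚ.*-distribˡ-+ c (bias a b ℚ.* 𝔼 x h) (bias b a ℚ.* 𝔼 y h))))
  where open import Algebra.Properties.CommutativeSemigroup
          (CommutativeMonoid.commutativeSemigroup ℚ.*-1-commutativeMonoid) using (x∙yz≈y∙xz)

𝔼-mix : ∀ (d : Dist A) p q (g h : A → ℚ) →
        𝔼 d (λ x → p ℚ.* g x ℚ.+ q ℚ.* h x) ≡ p ℚ.* 𝔼 d g ℚ.+ q ℚ.* 𝔼 d h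
𝔼-mix d p q g h =
  trans (𝔼-+ d (λ x → p ℚ.* g x) (λ x → q ℚ.* h x)) (cong₂ ℚ._+_ (𝔼-*ˡ d p g) (𝔼-*ˡ d q h))

𝔼-swap : ∀ (d : Dist A) (d′ : Dist B) (h : A → B → ℚ) →
         𝔼 d (λ x → 𝔼 d′ (h x)) ≡ 𝔼 d′ (λ y → 𝔼 d (λ x → h x y))
𝔼-swap (pure x)       d′ h = refl
𝔼-swap (coin a b x y) d′ h =
  trans (cong₂ (λ p q → bias a b ℚ.* p ℚ.+ bias b a ℚ.* q) (𝔼-swap x d′ h) (𝔼-swap y d′ h))
        (sym (𝔼-mix d′ (bias a b) (bias b a) _ _))

Always->>=⁺ : ∀ {P : A → Set} {Q : B → Set} (d : Dist A) {f : A → Dist B} →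
              (∀ x → P x → Always Q (f x)) → Always P d → Always Q (d >>= f)
Always->>=⁺ (pure x)       g p       = g x p
Always->>=⁺ (coin _ _ x y) g (p , q) = Always->>=⁺ x g p , Always->>=⁺ y g q

Always-universal : ∀ {P : A → Set} (d : Dist A) → (∀ x → P x) → Always P d
Always-universal (pure x)       f = f x
Always-universal (coin _ _ x y) f = Always-universal x f , Always-universal y f

Always-witness : ∀ {P : A → Set} (d : Dist A) → Always P d → A
Always-witness (pure x)       p       = x
Always-witness (coin _ _ x y) (p , _) = Always-witness x p

Always-witness-spec : ∀ {P : A → Set} (d : Dist A) (p : Always P d) → P (Always-witness d p)
Always-witness-spec (pure x)       p       = p
Always-witness-spec (coin _ _ x y) (p , _) = Always-witness-spec x p

-- Fair bits and nonzero linear forms over 𝔽₂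

bits : ∀ D → Dist (Vec Bool D)
bits zero    = pure []
bits (suc D) = fairCoin (mapDist (true ∷_) (bits D)) (mapDist (false ∷_) (bits D))

fair : ℚ → ℚ → ℚ
fair x y = bias 0 0 ℚ.* x ℚ.+ bias 0 0 ℚ.* y

fair-comm : ∀ x y → fair x y ≡ fair y x
fair-comm x y = ℚ.+-comm (bias 0 0 ℚ.* x) (bias 0 0 ℚ.* y)

𝔼-bits-suc : ∀ D (h : Vec Bool (suc D) → ℚ) →
             𝔼 (bits (suc D)) h ≡ fair (𝔼 (bits D) (h ∘ (true ∷_))) (𝔼 (bits D) (h ∘ (false ∷_)))
𝔼-bits-suc D h = cong₂ fair (𝔼->>= (bits D) _ h) (𝔼->>= (bits D) _ h)

infixl 7 _∙_
_∙_ : ∀ {D} → Vec Bool D → Vec Bool D → Bool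
[]      ∙ []      = false
(u ∷ U) ∙ (t ∷ T) = (u ∧ t) xor (U ∙ T)

zeros : ∀ D → Vec Bool D
zeros D = replicate D false

-- The nonempty sets `U` as characteristic vectors. In this order `zeros (suc D) ∷ nonzeros (suc D)`
-- unfolds by computation into two copies of the cube of dimension `D`, as `cube-sum` needs.
nonzeros : ∀ D → List (Vec Bool D)
nonzeros zero    = []
nonzeros (suc D) =
  List.map (false ∷_) (nonzeros D) List.++ List.map (true ∷_) (zeros D ∷ nonzeros D)

-- Uniformity is expressed by test functions `h`, because it is applied with an expectation over
-- other cells in the place of `h`.
Fair : ∀ {D} → Vec Bool D → Set
Fair {D} U = ∀ g (h : Bool → ℚ) → 𝔼 (bits D) (λ T → h (g xor (U ∙ T))) ≡ fair (h true) (h false)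

fair-xor : ∀ g (h : Bool → ℚ) → fair (h (g xor true)) (h (g xor false)) ≡ fair (h true) (h false)
fair-xor true  h = fair-comm (h false) (h true)
fair-xor false h = refl

fair-false∷ : ∀ {D} (U : Vec Bool D) → Fair U → Fair (false ∷ U)
fair-false∷ {D} U fU g h = begin
  𝔼 (bits (suc D)) (λ T → h (g xor ((false ∷ U) ∙ T)))  ≡⟨ 𝔼-bits-suc D (λ T → h (g xor ((false ∷ U) ∙ T))) ⟩
  fair (𝔼 (bits D) (λ T → h (g xor (U ∙ T)))) (𝔼 (bits D) (λ T → h (g xor (U ∙ T))))
   ≡⟨ cong₂ fair (fU g h) (fU g h) ⟩
  fair (fair (h true) (h false)) (fair (h true) (h false)) ≡⟨ mix-const 0 0 (fair (h true) (h false)) ⟩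
  fair (h true) (h false)                               ∎
  where open ≡-Reasoning

-- Condition on all bits of `T` but the first: whatever they are, the first bit then flips the value
-- of the form with probability 1/2.
fair-true∷ : ∀ {D} (U : Vec Bool D) → Fair (true ∷ U)
fair-true∷ {D} U g h = begin
  𝔼 (bits (suc D)) (λ T → h (g xor ((true ∷ U) ∙ T)))
    ≡⟨ 𝔼-bits-suc D (λ T → h (g xor ((true ∷ U) ∙ T))) ⟩
  fair (𝔼 (bits D) (λ T → h (g xor (true xor (U ∙ T))))) (𝔼 (bits D) (λ T → h (g xor (U ∙ T))))
    ≡⟨ 𝔼-mix (bits D) (bias 0 0) (bias 0 0) _ _ ⟨
  𝔼 (bits D) (λ T → fair (h (g xor (true xor (U ∙ T)))) (h (g xor (U ∙ T))))
    ≡⟨ 𝔼-cong (bits D) (λ T → lem (U ∙ T)) ⟩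
  𝔼 (bits D) (λ _ → fair (h true) (h false))
    ≡⟨ 𝔼-const (bits D) _ ⟩
  fair (h true) (h false) ∎
  where
  open ≡-Reasoning
  lem : ∀ b → fair (h (g xor (true xor b))) (h (g xor b)) ≡ fair (h true) (h false)
  lem false = fair-xor g h
  lem true  = trans (fair-comm (h (g xor false)) (h (g xor true))) (fair-xor g h)

nonzeros-fair : ∀ D → All Fair (nonzeros D)
nonzeros-fair zero    = []
nonzeros-fair (suc D) = All.++⁺
  (All.map⁺ (All.map (λ {U} → fair-false∷ U) (nonzeros-fair D)))
  (All.map⁺ (All.universal fair-true∷ (zeros D ∷ nonzeros D)))

-- Partially sampled tables: `completions p` fills the cells of p that have not
-- been sampled yet with fair bits.

Partial : ℕ → ℕ → Set
Partial D N = Vec (Maybe (Vec Bool D)) N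

Table : ℕ → ℕ → Set
Table D N = Vec (Vec Bool D) N

completions : ∀ {D N} → Partial D N → Dist (Table D N)
completions         []            = pure []
completions         (just t ∷ p)  = mapDist (t ∷_) (completions p)
completions {D} {_} (nothing ∷ p) = bits D >>= λ t → mapDist (t ∷_) (completions p)

infix 4 _Extends_
_Extends_ : ∀ {D N} → Table D N → Partial D N → Set
T Extends p = ∀ i {t} → lookup p i ≡ just t → lookup T i ≡ t

completions-extend : ∀ {D N} (p : Partial D N) → Always (_Extends p) (completions p)
completions-extend []            = λ ()
completions-extend (just t ∷ p)  =
  Always->>=⁺ (completions p) (λ T ext → λ { zero refl → refl ; (suc i) pf → ext i pf }) (completions-extend p)
completions-extend {D} (nothing ∷ p) = Always->>=⁺ {P = λ _ → Vec Bool D} (bits D)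
  (λ t _ → Always->>=⁺ (completions p) (λ T ext → λ { zero () ; (suc i) pf → ext i pf }) (completions-extend p))
  (Always-universal (bits D) id)

𝔼-completions-just : ∀ {D N} t (p : Partial D N) h →
  𝔼 (completions (just t ∷ p)) h ≡ 𝔼 (completions p) (h ∘ (t ∷_))
𝔼-completions-just t p h = 𝔼->>= (completions p) _ h

𝔼-completions-nothing : ∀ {D N} (p : Partial D N) h →
  𝔼 (completions (nothing ∷ p)) h ≡ 𝔼 (bits D) (λ t → 𝔼 (completions p) (h ∘ (t ∷_)))
𝔼-completions-nothing {D} p h =
  trans (𝔼->>= (bits D) _ h) (𝔼-cong (bits D) (λ t → 𝔼->>= (completions p) _ h))

-- The order in which the cells of a table are sampled does not matter.
𝔼-reveal : ∀ {D N} (p : Partial D N) i h → lookup p i ≡ nothing →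
  𝔼 (completions p) h ≡ 𝔼 (bits D) (λ t → 𝔼 (completions (p [ i ]≔ just t)) h)
𝔼-reveal {D} (nothing ∷ p) zero h refl =
  trans (𝔼-completions-nothing p h)
        (𝔼-cong (bits D) (λ t → sym (𝔼-completions-just t p h)))
𝔼-reveal {D} (just t ∷ p) (suc i) h pf = begin
  𝔼 (completions (just t ∷ p)) h        ≡⟨ 𝔼-completions-just t p h ⟩
  𝔼 (completions p) (h ∘ (t ∷_))        ≡⟨ 𝔼-reveal p i (h ∘ (t ∷_)) pf ⟩
  𝔼 (bits D) (λ u → 𝔼 (completions (p [ i ]≔ just u)) (h ∘ (t ∷_)))
    ≡⟨ 𝔼-cong (bits D) (λ u → sym (𝔼-completions-just t (p [ i ]≔ just u) h)) ⟩
  𝔼 (bits D) (λ u → 𝔼 (completions (just t ∷ p [ i ]≔ just u)) h) ∎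
  where open ≡-Reasoning
𝔼-reveal {D} (nothing ∷ p) (suc i) h pf = begin
  𝔼 (completions (nothing ∷ p)) h        ≡⟨ 𝔼-completions-nothing p h ⟩
  𝔼 (bits D) (λ t → 𝔼 (completions p) (h ∘ (t ∷_)))
    ≡⟨ 𝔼-cong (bits D) (λ t → 𝔼-reveal p i (h ∘ (t ∷_)) pf) ⟩
  𝔼 (bits D) (λ t → 𝔼 (bits D) (λ u → 𝔼 (completions (p [ i ]≔ just u)) (h ∘ (t ∷_))))
    ≡⟨ 𝔼-swap (bits D) (bits D) _ ⟩
  𝔼 (bits D) (λ u → 𝔼 (bits D) (λ t → 𝔼 (completions (p [ i ]≔ just u)) (h ∘ (t ∷_))))
    ≡⟨ 𝔼-cong (bits D) (λ u → sym (𝔼-completions-nothing (p [ i ]≔ just u) h)) ⟩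
  𝔼 (bits D) (λ u → 𝔼 (completions (nothing ∷ p [ i ]≔ just u)) h) ∎
  where open ≡-Reasoning

infixl 6 _⊕_
_⊕_ : ∀ {N} → Vec Bool N → Vec Bool N → Vec Bool N
_⊕_ = zipWith _xor_

-- A row of `T` holds the `D` bits of one cell, the unit of lazy sampling. The offsets rᵢ are
-- therefore the columns of `T`, and their sum over `U` is obtained by applying the form `U` to
-- every row.
query : ∀ {D N} → Vec Bool N → Vec Bool D → Table D N → Vec Bool N
query g U T = g ⊕ Vec.map (U ∙_) T

𝔼-query : ∀ {D} N {U : Vec Bool D} (g : Vec Bool N) → Fair U → (h : Vec Bool N → ℚ) →
  𝔼 (completions (replicate N nothing)) (h ∘ query g U) ≡ 𝔼 (bits N) h
𝔼-query zero    []      fU h = refl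
𝔼-query {D} (suc N) {U} (b ∷ g) fU h = begin
  𝔼 (completions (replicate (suc N) nothing)) (h ∘ query (b ∷ g) U)
    ≡⟨ 𝔼-completions-nothing (replicate N nothing) (h ∘ query (b ∷ g) U) ⟩
  𝔼 (bits D) (λ t → 𝔼 (completions (replicate N nothing)) (λ T → h ((b xor (U ∙ t)) ∷ query g U T)))
    ≡⟨ 𝔼-cong (bits D) (λ t → 𝔼-query N {U} g fU (λ v → h ((b xor (U ∙ t)) ∷ v))) ⟩
  𝔼 (bits D) (λ t → 𝔼 (bits N) (λ v → h ((b xor (U ∙ t)) ∷ v)))
    -- The test function is the expectation over the remaining cells, which is independent of the
    -- bits of this one.
    ≡⟨ fU b (λ c → 𝔼 (bits N) (λ v → h (c ∷ v))) ⟩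
  fair (𝔼 (bits N) (h ∘ (true ∷_))) (𝔼 (bits N) (h ∘ (false ∷_)))
    ≡⟨ 𝔼-bits-suc N h ⟨
  𝔼 (bits (suc N)) h ∎
  where open ≡-Reasoning

-- Polynomials over 𝔽₂

bit : Bool → ℕ
bit b = if b then 1 else 0

-- `Vanishing m F`: all m-fold derivatives of F vanish, that is, F is a
-- polynomial over 𝔽₂ of degree less than m.
Vanishing : ∀ {N} → ℕ → (Vec Bool N → Bool) → Set
Vanishing zero    F = ∀ x → F x ≡ false
Vanishing (suc m) F = ∀ r → Vanishing m (λ x → F x xor F (x ⊕ r))

vanishing-resp : ∀ {N} m {F H : Vec Bool N → Bool} → (∀ x → F x ≡ H x) → Vanishing m F → Vanishing m H
vanishing-resp zero    F≗H v x = trans (sym (F≗H x)) (v x)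
vanishing-resp (suc m) F≗H v r =
  vanishing-resp m (λ x → cong₂ _xor_ (F≗H x) (F≗H (x ⊕ r))) (v r)

vanishing-false : ∀ {N} m → Vanishing {N} m (λ _ → false)
vanishing-false zero    x = refl
vanishing-false (suc m) r = vanishing-false m

xor-interchange : ∀ a b c d → (a xor b) xor (c xor d) ≡ (a xor c) xor (b xor d)
xor-interchange false b c d =
  trans (sym (xor-assoc b c d)) (trans (cong (_xor d) (xor-comm b c)) (xor-assoc c b d))
xor-interchange true  false c     d = lem c d
  where
  lem : ∀ c d → true xor (c xor d) ≡ (true xor c) xor d
  lem true  true  = refl
  lem true  false = refl
  lem false d     = refl
xor-interchange true  true  true  d = refl
xor-interchange true  true  false d = sym (not-involutive d)

vanishing-xor : ∀ {N} m {F H : Vec Bool N → Bool} →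
                Vanishing m F → Vanishing m H → Vanishing m (λ x → F x xor H x)
vanishing-xor zero    v w x = cong₂ _xor_ (v x) (w x)
vanishing-xor (suc m) {F} {H} v w r = vanishing-resp m
  (λ x → xor-interchange (F x) (F (x ⊕ r)) (H x) (H (x ⊕ r))) (vanishing-xor m (v r) (w r))

vanishing-∧ : ∀ {N} m b {F : Vec Bool N → Bool} → Vanishing m F → Vanishing m (λ x → b ∧ F x)
vanishing-∧ m true  v = v
vanishing-∧ m false v = vanishing-false m

vanishing-suc : ∀ {N} m {F : Vec Bool N → Bool} → Vanishing m F → Vanishing (suc m) F
vanishing-suc zero    v r x = cong₂ _xor_ (v x) (v (x ⊕ r))
vanishing-suc (suc m) v r   = vanishing-suc m (v r)

vanishing-≤ : ∀ {N m m′} {F : Vec Bool N → Bool} → m ≤ m′ → Vanishing m F → Vanishing m′ F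
vanishing-≤ {m = m} le v = go (ℕ.≤⇒≤′ le) 
  where
  go : ∀ {m′} → m ℕ.≤′ m′ → Vanishing m′ _
  go ℕ.≤′-refl             = v
  go (ℕ.≤′-step {n} m≤′n) = vanishing-suc n (go m≤′n)

-- Leibniz: D_r (xᵢ F) = xᵢ D_r F + rᵢ (F + D_r F).
vanishing-coordinate : ∀ {N} m i {F : Vec Bool N → Bool} →
                       Vanishing m F → Vanishing (suc m) (λ x → lookup x i ∧ F x)
vanishing-coordinate zero i {F} v r x = cong₂ _xor_ (lem x) (lem (x ⊕ r))
  where
  lem : ∀ y → lookup y i ∧ F y ≡ false
  lem y = trans (cong (lookup y i ∧_) (v y)) (∧-zeroʳ (lookup y i))
vanishing-coordinate (suc m) i {F} v r = vanishing-resp (suc m) leibniz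
  (vanishing-xor (suc m) {λ x → lookup x i ∧ ΔF x} {λ x → lookup r i ∧ (F x xor ΔF x)}
    (vanishing-coordinate m i {ΔF} (v r))
    (vanishing-∧ (suc m) (lookup r i) {λ x → F x xor ΔF x}
      (vanishing-xor (suc m) {F} {ΔF} v (vanishing-suc m {ΔF} (v r)))))
  where
  ΔF : Vec Bool _ → Bool
  ΔF x = F x xor F (x ⊕ r)
  identity : ∀ a b f g → (a ∧ (f xor g)) xor (b ∧ (f xor (f xor g))) ≡ (a ∧ f) xor ((a xor b) ∧ g)
  identity false false f g = refl
  identity false true false g = refl
  identity false true true g = not-involutive g
  identity true false f g = xor-identityʳ (f xor g)
  identity true true f g =
    trans (xor-comm (f xor g) _)
    (trans (xor-assoc f (f xor g) (f xor g)) (cong (f xor_) (xor-same (f xor g))))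
  leibniz : ∀ x → _ ≡ _
  leibniz x = trans (identity (lookup x i) (lookup r i) (F x) (F (x ⊕ r)))
    (cong (λ b → (lookup x i ∧ F x) xor (b ∧ F (x ⊕ r))) (sym (Vec.lookup-zipWith _xor_ i x r)))

-- Sums over a cube of directions and self-correction

xorSum : {A : Set} → (A → Bool) → List A → Bool
xorSum f []       = false
xorSum f (x ∷ xs) = f x xor xorSum f xs

xorSum-++ : ∀ {A} (f : A → Bool) xs ys → xorSum f (xs List.++ ys) ≡ xorSum f xs xor xorSum f ys
xorSum-++ f []       ys = refl
xorSum-++ f (x ∷ xs) ys =
  trans (cong (f x xor_) (xorSum-++ f xs ys)) (sym (xor-assoc (f x) (xorSum f xs) (xorSum f ys)))

xorSum-map : ∀ {A B} (f : B → Bool) (g : A → B) xs → xorSum f (List.map g xs) ≡ xorSum (f ∘ g) xs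
xorSum-map f g []       = refl
xorSum-map f g (x ∷ xs) = cong (f (g x) xor_) (xorSum-map f g xs)

xorSum-cong : ∀ {A} {f g : A → Bool} → (∀ x → f x ≡ g x) → ∀ xs → xorSum f xs ≡ xorSum g xs
xorSum-cong f≗g []       = refl
xorSum-cong f≗g (x ∷ xs) = cong₂ _xor_ (f≗g x) (xorSum-cong f≗g xs)

xorSum-xor : ∀ {A} (f g : A → Bool) xs → xorSum (λ x → f x xor g x) xs ≡ xorSum f xs xor xorSum g xs
xorSum-xor f g []       = refl
xorSum-xor f g (x ∷ xs) =
  trans (cong ((f x xor g x) xor_) (xorSum-xor f g xs)) (xor-interchange (f x) (g x) (xorSum f xs) (xorSum g xs))

vanishing-xorSum : ∀ {N} {A : Set} m (F : A → Vec Bool N → Bool) xs →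
                   (∀ a → Vanishing m (F a)) → Vanishing m (λ x → xorSum (λ a → F a x) xs)
vanishing-xorSum m F []       v = vanishing-false m
vanishing-xorSum m F (a ∷ xs) v = vanishing-xor m (v a) (vanishing-xorSum m F xs v)

query-false : ∀ {D N} (g : Vec Bool N) (U : Vec Bool D) T →
              query g (false ∷ U) T ≡ query g U (Vec.map Vec.tail T)
query-false []      U []            = refl
query-false (b ∷ g) U ((t ∷ ts) ∷ T) = cong ((b xor (U ∙ ts)) ∷_) (query-false g U T)

query-true : ∀ {D N} (g : Vec Bool N) (U : Vec Bool D) T →
             query g (true ∷ U) T ≡ query g U (Vec.map Vec.tail T) ⊕ Vec.map Vec.head T
query-true []      U []             = refl
query-true (b ∷ g) U ((t ∷ ts) ∷ T) = cong₂ _∷_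
  (trans (cong (b xor_) (xor-comm t (U ∙ ts))) (sym (xor-assoc b (U ∙ ts) t)))
  (query-true g U T)

query-zeros : ∀ D {N} (g : Vec Bool N) T → query g (zeros D) T ≡ g
query-zeros D []      []      = refl
query-zeros D (b ∷ g) (t ∷ T) =
  cong₂ _∷_ (trans (cong (b xor_) (zeros-∙ D t)) (xor-identityʳ b)) (query-zeros D g T)
  where
  zeros-∙ : ∀ D (t : Vec Bool D) → zeros D ∙ t ≡ false
  zeros-∙ zero    []      = refl
  zeros-∙ (suc D) (_ ∷ t) = zeros-∙ D t

-- The two halves of the cube, given by the first coordinate of `U`, differ by a shift by the first
-- column `heads`. Pairing them turns the sum into one for the derivative of `F` in the direction
-- `heads`, over a cube of one dimension less.
cube-sum : ∀ {N} D {F : Vec Bool N → Bool} → Vanishing D F → (g : Vec Bool N) (T : Table D N) →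
           xorSum (λ U → F (query g U T)) (zeros D ∷ nonzeros D) ≡ false
cube-sum zero {F} v g T = trans (xor-identityʳ _) (v (query g [] T))
cube-sum (suc D) {F} v g T = begin
  xorSum φ (List.map (false ∷_) cube List.++ List.map (true ∷_) cube)
    ≡⟨ xorSum-++ φ (List.map (false ∷_) cube) _ ⟩
  xorSum φ (List.map (false ∷_) cube) xor xorSum φ (List.map (true ∷_) cube)
    ≡⟨ cong₂ _xor_ (xorSum-map φ (false ∷_) cube) (xorSum-map φ (true ∷_) cube) ⟩
  xorSum (φ ∘ (false ∷_)) cube xor xorSum (φ ∘ (true ∷_)) cube
    ≡⟨ xorSum-xor (φ ∘ (false ∷_)) (φ ∘ (true ∷_)) cube ⟨
  xorSum (λ U → φ (false ∷ U) xor φ (true ∷ U)) cube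
    ≡⟨ xorSum-cong (λ U → cong₂ (λ x y → F x xor F y) (query-false g U T) (query-true g U T)) cube ⟩
  xorSum (λ U → F (query g U tails) xor F (query g U tails ⊕ heads)) cube
    ≡⟨ cube-sum D (v heads) g tails ⟩
  false ∎
  where
  open ≡-Reasoning
  φ = λ U → F (query g U T)
  cube = zeros D ∷ nonzeros D
  heads = Vec.map Vec.head T
  tails = Vec.map Vec.tail T

self-correction : ∀ {N} D {F : Vec Bool N → Bool} → Vanishing D F → (g : Vec Bool N) (T : Table D N) →
                  F g ≡ xorSum (λ U → F (query g U T)) (nonzeros D)
self-correction D {F} v g T =
  xor-cancel (trans (cong (λ x → F x xor s) (sym (query-zeros D g T))) (cube-sum D v g T))
  where
  s = xorSum (λ U → F (query g U T)) (nonzeros D)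
  xor-cancel : ∀ {a b} → a xor b ≡ false → a ≡ b
  xor-cancel {false} {false} _ = refl
  xor-cancel {true}  {true}  _ = refl
  xor-cancel {false} {true}  ()
  xor-cancel {true}  {false} ()

-- Clique parity as a polynomial of bounded degree

allᵇ : {A : Set} → (A → Bool) → List A → Bool
allᵇ f []       = true
allᵇ f (x ∷ xs) = f x ∧ allᵇ f xs

allᵇ-cong : {A : Set} {f g : A → Bool} → (∀ x → f x ≡ g x) → ∀ xs → allᵇ f xs ≡ allᵇ g xs
allᵇ-cong f≗g []       = refl
allᵇ-cong f≗g (x ∷ xs) = cong₂ _∧_ (f≗g x) (allᵇ-cong f≗g xs)

all?-allᵇ : {A : Set} {P : A → Set} (P? : ∀ x → Dec (P x)) → ∀ xs → does (All.all? P? xs) ≡ allᵇ (does ∘ P?) xs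
all?-allᵇ P? []       = refl
all?-allᵇ P? (x ∷ xs) = cong (does (P? x) ∧_) (all?-allᵇ P? xs)

-- Each factor is either constantly true or the indicator of a single hyperedge, so the conjunction
-- is a monomial over 𝔽₂.
cliqueᵇ : ∀ {n s k} → Hypergraph n s → Choose n k → Bool
cliqueᵇ {n} {s} G (S , _) = allᵇ (λ e → not (does (proj₁ e ⊆? S)) ∨ G e) (choose n s)

isClique?-cliqueᵇ : ∀ {n s k} (G : Hypergraph n s) (S : Choose n k) → does (isClique? G S) ≡ cliqueᵇ G S
isClique?-cliqueᵇ {n} {s} G (S , _) =
  trans (all?-allᵇ (λ e → (proj₁ e ⊆? S) →-dec T? (G e)) (choose n s)) refl

cliqueᵇ-cong : ∀ {n s k} {G H : Hypergraph n s} → (∀ e → G e ≡ H e) → (S : Choose n k) → cliqueᵇ G S ≡ cliqueᵇ H S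
cliqueᵇ-cong {n} {s} G≗H (S , _) = allᵇ-cong (λ e → cong (not (does (proj₁ e ⊆? S)) ∨_) (G≗H e)) (choose n s)

parity : ∀ {n s} → ℕ → Hypergraph n s → Bool
parity {n} k G = xorSum (cliqueᵇ G) (choose n k)

parity-cong : ∀ {n s} k {G H : Hypergraph n s} → (∀ e → G e ≡ H e) → parity k G ≡ parity k H
parity-cong {n} k G≗H = xorSum-cong (cliqueᵇ-cong G≗H) (choose n k)

suc-%2 : ∀ m b → m % 2 ≡ bit b → suc m % 2 ≡ bit (not b)
suc-%2 m b m≡b = trans (%-distribˡ-+ 1 m 2) (trans (cong (λ r → (1 ℕ.+ r) % 2) m≡b) (lem b))
  where
  lem : ∀ b → (1 ℕ.+ bit b) % 2 ≡ bit (not b)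
  lem true  = refl
  lem false = refl

filter-parity : {A : Set} {P : A → Set} (P? : ∀ x → Dec (P x)) (f : A → Bool) → (∀ x → does (P? x) ≡ f x) →
                ∀ xs → length (filter P? xs) % 2 ≡ bit (xorSum f xs)
filter-parity P? f P?≗f []       = refl
filter-parity P? f P?≗f (x ∷ xs) with f x | does (P? x) | P?≗f x
... | true  | _ | refl = suc-%2 (length (filter P? xs)) (xorSum f xs) (filter-parity P? f P?≗f xs)
... | false | _ | refl = filter-parity P? f P?≗f xs

cliqueParity-parity : ∀ {n s} k (G : Hypergraph n s) → cliqueParity k G ≡ bit (parity k G)
cliqueParity-parity {n} k G = filter-parity (isClique? G) (cliqueᵇ G) (isClique?-cliqueᵇ G) (choose n k)

count : {A : Set} → (A → Bool) → List A → ℕ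
count f []       = 0
count f (x ∷ xs) = bit (f x) ℕ.+ count f xs

-- The constant true has order 1, and each entry selected by `f` multiplies by one more variable;
-- the other factors are constant.
vanishing-monomial : ∀ {N} {A : Set} (pos : A → Fin N) (f : A → Bool) (xs : List A) →
  Vanishing (suc (count f xs)) (λ v → allᵇ (λ a → not (f a) ∨ lookup v (pos a)) xs)
vanishing-monomial pos f []       r x = refl
vanishing-monomial pos f (a ∷ xs) with f a
... | true  =
  vanishing-coordinate (suc (count f xs)) (pos a)
  {λ v → allᵇ (λ b → not (f b) ∨ lookup v (pos b)) xs} (vanishing-monomial pos f xs)
... | false = vanishing-monomial pos f xs

count-map : ∀ {A B : Set} (f : B → Bool) (g : A → B) xs → count f (List.map g xs) ≡ count (f ∘ g) xs
count-map f g []       = refl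
count-map f g (x ∷ xs) = cong (bit (f (g x)) ℕ.+_) (count-map f g xs)

count-++ : ∀ {A : Set} (f : A → Bool) xs ys → count f (xs List.++ ys) ≡ count f xs ℕ.+ count f ys
count-++ f []       ys = refl
count-++ f (x ∷ xs) ys = trans (cong (bit (f x) ℕ.+_) (count-++ f xs ys)) (sym (ℕ.+-assoc (bit (f x)) _ _))

count-≤ : ∀ {A : Set} {f g : A → Bool} → (∀ x → bit (f x) ≤ bit (g x)) → ∀ xs → count f xs ≤ count g xs
count-≤ f≤g []       = z≤n
count-≤ f≤g (x ∷ xs) = ℕ.+-mono-≤ (f≤g x) (count-≤ f≤g xs)

count-false : ∀ {A : Set} {f : A → Bool} → (∀ x → f x ≡ false) → ∀ xs → count f xs ≡ 0
count-false f≗ []       = refl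
count-false f≗ (x ∷ xs) rewrite f≗ x = count-false f≗ xs

bit-mono : ∀ {P Q : Set} (P? : Dec P) (Q? : Dec Q) → (P → Q) → bit (does P?) ≤ bit (does Q?)
bit-mono (yes p) (yes q) f = ℕ.≤-refl
bit-mono (yes p) (no ¬q) f with () ← ¬q (f p)
bit-mono (no ¬p) Q?      f = z≤n

-- The degree only has to be bounded independently of `n`. All subsets of `S` are counted, instead
-- of those of size `s`, because this crude bound follows directly from the recursion of `choose`.
count-subsets : ∀ n s (S : Subset n) → count (λ e → does (proj₁ e ⊆? S)) (choose n s) ≤ 2 ^ ∣ S ∣
count-subsets zero    zero    []           = s≤s z≤n
count-subsets zero    (suc s) []           = z≤n
count-subsets (suc n) zero    (x ∷ S)      = begin
  count (λ e → does (proj₁ e ⊆? (x ∷ S))) (choose (suc n) 0) ≡⟨ count-map (λ e → does (proj₁ e ⊆? (x ∷ S))) _ (choose n 0) ⟩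
  count (λ e → does ((outside ∷ proj₁ e) ⊆? (x ∷ S))) (choose n 0)
    ≤⟨ count-≤ (λ e → bit-mono ((outside ∷ proj₁ e) ⊆? (x ∷ S)) (proj₁ e ⊆? S) drop-∷-⊆) (choose n 0) ⟩
  count (λ e → does (proj₁ e ⊆? S)) (choose n 0) ≤⟨ count-subsets n 0 S ⟩
  2 ^ ∣ S ∣ ≤⟨ ℕ.^-monoʳ-≤ 2 (∣p∣≤∣x∷p∣ x S) ⟩
  2 ^ ∣ x ∷ S ∣ ∎
  where open ℕ.≤-Reasoning
count-subsets (suc n) (suc s) (inside ∷ S) = begin
  count f (choose (suc n) (suc s)) ≡⟨ count-++ f (List.map _ (choose n s)) _ ⟩
  count f (List.map _ (choose n s)) ℕ.+ count f (List.map _ (choose n (suc s)))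
    ≡⟨ cong₂ ℕ._+_ (count-map f _ (choose n s)) (count-map f _ (choose n (suc s))) ⟩
  count (λ e → does ((inside ∷ proj₁ e) ⊆? (inside ∷ S))) (choose n s) ℕ.+
  count (λ e → does ((outside ∷ proj₁ e) ⊆? (inside ∷ S))) (choose n (suc s))
    ≤⟨ ℕ.+-mono-≤
         (count-≤ (λ e → bit-mono ((inside ∷ proj₁ e) ⊆? (inside ∷ S)) (proj₁ e ⊆? S) drop-∷-⊆) (choose n s))
         (count-≤ (λ e → bit-mono ((outside ∷ proj₁ e) ⊆? (inside ∷ S)) (proj₁ e ⊆? S) drop-∷-⊆)
           (choose n (suc s))) ⟩
  count (λ e → does (proj₁ e ⊆? S)) (choose n s) ℕ.+ count (λ e → does (proj₁ e ⊆? S)) (choose n (suc s))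
    ≤⟨ ℕ.+-mono-≤ (count-subsets n s S) (count-subsets n (suc s) S) ⟩
  2 ^ ∣ S ∣ ℕ.+ 2 ^ ∣ S ∣ ≡⟨ cong (2 ^ ∣ S ∣ ℕ.+_) (ℕ.+-identityʳ _) ⟨
  2 ^ suc ∣ S ∣ ∎
  where
  open ℕ.≤-Reasoning
  f : Choose (suc n) (suc s) → Bool
  f e = does (proj₁ e ⊆? (inside ∷ S))
count-subsets (suc n) (suc s) (outside ∷ S) = begin
  count f (choose (suc n) (suc s)) ≡⟨ count-++ f (List.map _ (choose n s)) _ ⟩
  count f (List.map _ (choose n s)) ℕ.+ count f (List.map _ (choose n (suc s)))
    ≡⟨ cong₂ ℕ._+_ (count-map f _ (choose n s)) (count-map f _ (choose n (suc s))) ⟩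
  count (λ e → does ((inside ∷ proj₁ e) ⊆? (outside ∷ S))) (choose n s) ℕ.+
  count (λ e → does ((outside ∷ proj₁ e) ⊆? (outside ∷ S))) (choose n (suc s))
    ≤⟨ ℕ.+-mono-≤
         (ℕ.≤-reflexive (count-false (λ e → dec-false ((inside ∷ proj₁ e) ⊆? (outside ∷ S)) in⊈out) (choose n s)))
         (count-≤ (λ e → bit-mono ((outside ∷ proj₁ e) ⊆? (outside ∷ S)) (proj₁ e ⊆? S) drop-∷-⊆)
           (choose n (suc s))) ⟩
  count (λ e → does (proj₁ e ⊆? S)) (choose n (suc s)) ≤⟨ count-subsets n (suc s) S ⟩
  2 ^ ∣ S ∣ ∎
  where
  open ℕ.≤-Reasoning
  f : Choose (suc n) (suc s) → Bool
  f e = does (proj₁ e ⊆? (outside ∷ S))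
  in⊈out : ∀ {m} {p q : Subset m} → ¬ ((inside ∷ p) ⊆ (outside ∷ q))
  in⊈out p⊆q with () ← p⊆q here

-- Hypergraphs as bit vectors

Choose-≡ : ∀ {n k} {S S′ : Choose n k} → proj₁ S ≡ proj₁ S′ → S ≡ S′
Choose-≡ {S = S , p} {S′ = .S , q} refl = cong (S ,_) (ℕ.≡-irrelevant p q)

choose-unique : ∀ n k → Unique (choose n k)
choose-unique zero    zero    = [] ∷ []
choose-unique zero    (suc k) = []
choose-unique (suc n) zero    =
  Unique.map⁺ (λ pf → Choose-≡ (Vec.∷-injectiveʳ (cong proj₁ pf))) (choose-unique n zero)
choose-unique (suc n) (suc k) = Unique.++⁺
  (Unique.map⁺ (λ pf → Choose-≡ (Vec.∷-injectiveʳ (cong proj₁ pf))) (choose-unique n k))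
  (Unique.map⁺ (λ pf → Choose-≡ (Vec.∷-injectiveʳ (cong proj₁ pf))) (choose-unique n (suc k)))
  disjoint
  where
  disjoint : ∀ {S} → ¬ (S ∈ List.map _ (choose n k) × S ∈ List.map _ (choose n (suc k)))
  disjoint (S∈ , S∈′) with ∈-map⁻ _ S∈ | ∈-map⁻ _ S∈′
  ... | _ , _ , refl | _ , _ , pf with () ← Vec.∷-injectiveˡ (cong proj₁ pf)

lookup-injective : {A : Set} {xs : List A} → Unique xs → ∀ {i j} → List.lookup xs i ≡ List.lookup xs j → i ≡ j
lookup-injective {xs = x ∷ xs} (x∉ ∷ u) {zero}  {zero}  pf = refl
lookup-injective {xs = x ∷ xs} (x∉ ∷ u) {zero}  {suc j} pf = contradiction pf (All.lookup x∉ (∈-lookup j))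
lookup-injective {xs = x ∷ xs} (x∉ ∷ u) {suc i} {zero}  pf = contradiction (sym pf) (All.lookup x∉ (∈-lookup i))
lookup-injective {xs = x ∷ xs} (x∉ ∷ u) {suc i} {suc j} pf = cong suc (lookup-injective u pf)

#edges : ℕ → ℕ → ℕ
#edges n s = length (choose n s)

edge : ∀ {n s} → Fin (#edges n s) → Choose n s
edge {n} {s} = List.lookup (choose n s)

ix : ∀ {n s} → Choose n s → Fin (#edges n s)
ix e = index (∈-choose e)

edge-ix : ∀ {n s} (e : Choose n s) → edge (ix e) ≡ e
edge-ix e = sym (lookup-index (∈-choose e))

ix-edge : ∀ {n s} (i : Fin (#edges n s)) → ix (edge {n} {s} i) ≡ i
ix-edge {n} {s} i = lookup-injective (choose-unique n s) (edge-ix (edge i))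

graph : ∀ {n s} → Vec Bool (#edges n s) → Hypergraph n s
graph v e = lookup v (ix e)

vector : ∀ {n s} → Hypergraph n s → Vec Bool (#edges n s)
vector G = Vec.tabulate (G ∘ edge)

graph-vector : ∀ {n s} (G : Hypergraph n s) e → graph (vector G) e ≡ G e
graph-vector G e = trans (Vec.lookup∘tabulate (G ∘ edge) (ix e)) (cong G (edge-ix e))

graphOf : ∀ {n s} (L : List (Choose n s)) → Vec Bool (length L) → Hypergraph n s
graphOf []      []      = λ _ → false
graphOf (e ∷ L) (b ∷ v) = if b then insertEdge e (graphOf L v) else graphOf L v

-- A copy of the local function of `randomHypergraph`, with the same unfolding. It allows an
-- induction over arbitrary lists of hyperedges in place of `choose n s`.
addEdge : ∀ {n s} → Choose n s → Dist (Hypergraph n s) → Dist (Hypergraph n s)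
addEdge e D = D >>= λ G → fairCoin (pure (insertEdge e G)) (pure G)

𝔼-graphOf : ∀ {n s} (L : List (Choose n s)) (h : Hypergraph n s → ℚ) →
  𝔼 (foldr addEdge (pure (λ _ → false)) L) h ≡ 𝔼 (bits (length L)) (h ∘ graphOf L)
𝔼-graphOf []      h = refl
𝔼-graphOf (e ∷ L) h = begin
  𝔼 (foldr addEdge (pure (λ _ → false)) (e ∷ L)) h
    ≡⟨ 𝔼->>= (foldr addEdge (pure (λ _ → false)) L) _ h ⟩
  𝔼 (foldr addEdge (pure (λ _ → false)) L) (λ G → fair (h (insertEdge e G)) (h G))
    ≡⟨ 𝔼-graphOf L _ ⟩
  𝔼 (bits (length L)) (λ v → fair (h (insertEdge e (graphOf L v))) (h (graphOf L v)))
    ≡⟨ 𝔼-mix (bits (length L)) (bias 0 0) (bias 0 0) _ _ ⟩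
  fair (𝔼 (bits (length L)) (h ∘ graphOf (e ∷ L) ∘ (true ∷_)))
    (𝔼 (bits (length L)) (h ∘ graphOf (e ∷ L) ∘ (false ∷_)))
    ≡⟨ 𝔼-bits-suc (length L) (h ∘ graphOf (e ∷ L)) ⟨
  𝔼 (bits (suc (length L))) (h ∘ graphOf (e ∷ L)) ∎
  where open ≡-Reasoning

insertEdge-≡ : ∀ {n s} (e : Choose n s) G → insertEdge e G e ≡ true
insertEdge-≡ (e , _) G rewrite dec-true (Vec.≡-dec _≟ᵇ_ e e) refl = refl

insertEdge-≢ : ∀ {n s} {e e′ : Choose n s} → e ≢ e′ → ∀ G → insertEdge e G e′ ≡ G e′
insertEdge-≢ {e = e} {e′} e≢e′ G
  rewrite dec-false (Vec.≡-dec _≟ᵇ_ (proj₁ e) (proj₁ e′)) (e≢e′ ∘ Choose-≡) = refl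

graphOf-∉ : ∀ {n s} (L : List (Choose n s)) v {e} → All.All (_≢ e) L → graphOf L v e ≡ false
graphOf-∉ []      []          []         = refl
graphOf-∉ (_ ∷ L) (true  ∷ v) (≢e ∷ ≢es) = trans (insertEdge-≢ ≢e (graphOf L v)) (graphOf-∉ L v ≢es)
graphOf-∉ (_ ∷ L) (false ∷ v) (≢e ∷ ≢es) = graphOf-∉ L v ≢es

graphOf-lookup : ∀ {n s} (L : List (Choose n s)) → Unique L → ∀ v i → graphOf L v (List.lookup L i) ≡ lookup v i
graphOf-lookup (e ∷ L) (e∉ ∷ u) (true  ∷ v) zero    = insertEdge-≡ e (graphOf L v)
graphOf-lookup (e ∷ L) (e∉ ∷ u) (false ∷ v) zero    = graphOf-∉ L v (All.map (_∘ sym) e∉)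
graphOf-lookup (e ∷ L) (e∉ ∷ u) (true  ∷ v) (suc i) =
  trans (insertEdge-≢ (All.lookup e∉ (∈-lookup i)) (graphOf L v)) (graphOf-lookup L u v i)
graphOf-lookup (e ∷ L) (e∉ ∷ u) (false ∷ v) (suc i) = graphOf-lookup L u v i

-- The hypergraph built by successive insertions and `graph v` agree only pointwise, so `h` has to
-- respect pointwise equality.
𝔼-randomHypergraph : ∀ n s (h : Hypergraph n s → ℚ) → (∀ {G H} → (∀ e → G e ≡ H e) → h G ≡ h H) →
  𝔼 (randomHypergraph n s) h ≡ 𝔼 (bits (#edges n s)) (h ∘ graph)
𝔼-randomHypergraph n s h h-cong = trans (𝔼-graphOf (choose n s) h) (𝔼-cong (bits (#edges n s)) λ v →
  h-cong λ e → trans (cong (graphOf (choose n s) v) (sym (edge-ix e)))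
                     (graphOf-lookup (choose n s) (choose-unique n s) v (ix e)))

-- Addresses of hyperedges in the input array

elements-injective : ∀ {n} (S S′ : Subset n) → elements S ≡ elements S′ → S ≡ S′
elements-injective []            []             pf = refl
elements-injective (inside ∷ S)  (inside ∷ S′)  pf =
  cong (inside ∷_) (elements-injective S S′ (List.map-injective ℕ.suc-injective (List.∷-injectiveʳ pf)))
elements-injective (outside ∷ S) (outside ∷ S′) pf =
  cong (outside ∷_) (elements-injective S S′ (List.map-injective ℕ.suc-injective pf))
elements-injective (inside ∷ S)  (outside ∷ S′) pf with elements S′ | pf
... | []    | ()
... | _ ∷ _ | ()
elements-injective (outside ∷ S) (inside ∷ S′)  pf with elements S | pf
... | []    | ()
... | _ ∷ _ | ()

length-elements : ∀ {n} (S : Subset n) → length (elements S) ≡ ∣ S ∣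
length-elements []            = refl
length-elements (inside ∷ S)  = cong suc (trans (List.length-map suc (elements S)) (length-elements S))
length-elements (outside ∷ S) = trans (List.length-map suc (elements S)) (length-elements S)

vertices : ∀ {n s} → Fin (#edges n s) → List ℕ
vertices {n} {s} i = elements (proj₁ (edge {n} {s} i))

length-vertices : ∀ {n s} (i : Fin (#edges n s)) → length (vertices {n} {s} i) ≡ s
length-vertices {n} {s} i = trans (length-elements (proj₁ (edge {n} {s} i))) (proj₂ (edge {n} {s} i))

vertices-injective : ∀ {n s} {i j : Fin (#edges n s)} → vertices {n} {s} i ≡ vertices {n} {s} j → i ≡ j
vertices-injective {n} {s} pf = lookup-injective (choose-unique n s) (Choose-≡ (elements-injective _ _ pf))

-- The partial inverse of `vertices`. It separates the address from the value of the hyperedge,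
-- which `encode` tests together.
findEdge : ∀ n s → List ℕ → Maybe (Fin (#edges n s))
findEdge n s vs with any? (λ e → List.≡-dec ℕ._≟_ (elements (proj₁ e)) vs) (choose n s)
... | yes p = just (index p)
... | no  _ = nothing

findEdge-just : ∀ n s {vs i} → findEdge n s vs ≡ just i → vertices {n} {s} i ≡ vs
findEdge-just n s {vs} pf with any? (λ e → List.≡-dec ℕ._≟_ (elements (proj₁ e)) vs) (choose n s) | pf
... | yes p | refl = lookup-index p

findEdge-vertices : ∀ n s i → findEdge n s (vertices {n} {s} i) ≡ just i
findEdge-vertices n s i with any? (λ e → List.≡-dec ℕ._≟_ (elements (proj₁ e)) (vertices {n} {s} i)) (choose n s)
... | yes p = cong just (vertices-injective {n} {s} (lookup-index p))
... | no ¬p = contradiction (Any.map (λ pf → cong (elements ∘ proj₁) (sym pf)) (∈-lookup {xs = choose n s} i)) ¬p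

encode-findEdge : ∀ {n s} (G : Hypergraph n s) vs →
                  encode G vs ≡ maybe′ (bit ∘ G ∘ edge) 0 (findEdge n s vs)
encode-findEdge {n} {s} G vs
  with any? (λ e → List.≡-dec ℕ._≟_ (elements (proj₁ e)) vs ×-dec T? (G e)) (choose n s)
     | any? (λ e → List.≡-dec ℕ._≟_ (elements (proj₁ e)) vs) (choose n s)
... | yes p | no ¬q = contradiction (Any.map proj₁ p) ¬q
... | no _  | no _  = refl
... | yes p | yes q with lookup-index p
...   | v≡ , Ge rewrite vertices-injective {n} {s} (trans (lookup-index q) (sym v≡)) = sym (T-bit Ge)
  where
  T-bit : ∀ {b} → T b → bit b ≡ 1
  T-bit {true} _ = refl
encode-findEdge {n} {s} G vs | no ¬p | yes q with G (edge (index q)) in pf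
... | false = refl
... | true  = contradiction
  (Any.map (λ { refl → lookup-index q , subst T (sym pf) _ }) (∈-lookup {xs = choose n s} (index q))) ¬p

encode-cong : ∀ {n s} {G H : Hypergraph n s} → (∀ e → G e ≡ H e) → ∀ vs → encode G vs ≡ encode H vs
encode-cong {n} {s} {G} {H} G≗H vs = trans (encode-findEdge G vs)
  (trans (lem (findEdge n s vs)) (sym (encode-findEdge H vs)))
  where
  lem : ∀ m → maybe′ (bit ∘ G ∘ edge) 0 m ≡ maybe′ (bit ∘ H ∘ edge) 0 m
  lem (just i) = cong bit (G≗H (edge i))
  lem nothing  = refl

-- A test that a program can evaluate with a bounded number of comparisons; on tuples of length `s`
-- it decides whether `findEdge` succeeds. Comparing the last entry with `n` bounds all of them.
increasing : ℕ → List ℕ → Bool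
increasing n []           = true
increasing n (v ∷ [])     = v <ᵇ n
increasing n (v ∷ w ∷ vs) = (v <ᵇ w) ∧ increasing n (w ∷ vs)

increasing-map-suc : ∀ n vs → increasing (suc n) (List.map suc vs) ≡ increasing n vs
increasing-map-suc n []           = refl
increasing-map-suc n (v ∷ [])     = refl
increasing-map-suc n (v ∷ w ∷ vs) = cong ((v <ᵇ w) ∧_) (increasing-map-suc n (w ∷ vs))

increasing-elements : ∀ {n} (S : Subset n) → increasing n (elements S) ≡ true
increasing-elements []            = refl
increasing-elements (outside ∷ S) = trans (increasing-map-suc _ (elements S)) (increasing-elements S)
increasing-elements {suc n} (inside ∷ S) with elements S | increasing-elements S
... | []    | _   = refl
... | v ∷ vs | inc = trans (increasing-map-suc n (v ∷ vs)) inc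

increasing-tail : ∀ n v w vs → increasing n (v ∷ w ∷ vs) ≡ true → (v <ᵇ w) ≡ true × increasing n (w ∷ vs) ≡ true
increasing-tail n v w vs inc with v <ᵇ w | inc
... | true | inc′ = refl , inc′

increasing-positive : ∀ n v vs → increasing (suc n) (suc v ∷ vs) ≡ true →
                      ∃[ ws ] suc v ∷ vs ≡ List.map suc ws × increasing n ws ≡ true
increasing-positive n v []           inc = v ∷ [] , refl , inc
increasing-positive n v (zero ∷ vs)  inc with () ← proj₁ (increasing-tail (suc n) (suc v) zero vs inc)
increasing-positive n v (suc w ∷ vs) inc with increasing-tail (suc n) (suc v) (suc w) vs inc
... | v<w , inc′ with increasing-positive n w vs inc′
...   | u ∷ ws , refl , inc″ = v ∷ u ∷ ws , refl , cong₂ _∧_ v<w inc″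

¬increasing-zero : ∀ v vs → increasing 0 (v ∷ vs) ≢ true
¬increasing-zero v (w ∷ vs) inc = ¬increasing-zero w vs (proj₂ (increasing-tail 0 v w vs inc))

increasing-subset : ∀ n vs → increasing n vs ≡ true → ∃[ S ] elements {n} S ≡ vs
increasing-subset zero []           inc = [] , refl
increasing-subset zero (v ∷ vs)     inc = contradiction inc (¬increasing-zero v vs)
increasing-subset (suc n) [] inc with increasing-subset n [] refl
... | S , pf = outside ∷ S , cong (List.map suc) pf
increasing-subset (suc n) (zero ∷ []) inc with increasing-subset n [] refl
... | S , pf = inside ∷ S , cong (λ vs → 0 ∷ List.map suc vs) pf
increasing-subset (suc n) (zero ∷ zero ∷ vs) ()
increasing-subset (suc n) (zero ∷ suc w ∷ vs) inc with increasing-positive n w vs inc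
... | ws , pf , inc′ with increasing-subset n ws inc′
...   | S , refl = inside ∷ S , cong (0 ∷_) (sym pf)
increasing-subset (suc n) (suc v ∷ vs) inc with increasing-positive n v vs inc
... | ws , pf , inc′ with increasing-subset n ws inc′
...   | S , refl = outside ∷ S , sym pf

findEdge-increasing : ∀ n s vs → length vs ≡ s → increasing n vs ≡ true → ∃[ i ] findEdge n s vs ≡ just i
findEdge-increasing n s vs len inc with increasing-subset n vs inc
... | S , refl =
  ix e , trans (cong (λ e → findEdge n s (elements (proj₁ e))) (sym (edge-ix e)))
  (findEdge-vertices n s (ix e))
  where
  e : Choose n s
  e = S , trans (sym (length-elements S)) len

findEdge-¬increasing : ∀ n s vs → increasing n vs ≡ false → findEdge n s vs ≡ nothing
findEdge-¬increasing n s vs ¬inc with findEdge n s vs in pf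
... | nothing = refl
... | just i with () ← trans (sym (increasing-elements (proj₁ (edge {n} {s} i))))
  (trans (cong (increasing n) (findEdge-just n s pf)) ¬inc)

-- Runs of word-RAM programs

-- Memories are functions and are compared only pointwise. Runs from pointwise equal memories are
-- therefore not identified: they are trees with the same coins whose leaves are related.
data Coupled {A : Set} (R : A → A → Set) : Dist A → Dist A → Set where
  pure : ∀ {x y} → R x y → Coupled R (pure x) (pure y)
  coin : ∀ a b {x x′ y y′} → Coupled R x x′ → Coupled R y y′ → Coupled R (coin a b x y) (coin a b x′ y′)

Coupled->>= : ∀ {A B : Set} {R : A → A → Set} {Q : B → B → Set} {d d′ : Dist A} {f g : A → Dist B} →
  Coupled R d d′ → (∀ {x y} → R x y → Coupled Q (f x) (g y)) → Coupled Q (d >>= f) (d′ >>= g)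
Coupled->>= (pure r)       k = k r
Coupled->>= (coin a b c d) k = coin a b (Coupled->>= c k) (Coupled->>= d k)

Coupled-𝔼 : ∀ {A : Set} {R : A → A → Set} {d d′ : Dist A} {h : A → ℚ} →
  Coupled R d d′ → (∀ {x y} → R x y → h x ≡ h y) → 𝔼 d h ≡ 𝔼 d′ h
Coupled-𝔼 (pure r)       k = k r
Coupled-𝔼 (coin a b c d) k = cong₂ (λ p q → bias a b ℚ.* p ℚ.+ bias b a ℚ.* q) (Coupled-𝔼 c k) (Coupled-𝔼 d k)

Coupled-Always : ∀ {A : Set} {R : A → A → Set} {P : A → Set} {d d′ : Dist A} →
  Coupled R d d′ → (∀ {x y} → R x y → P x → P y) → Always P d → Always P d′
Coupled-Always (pure r)       k p       = k r p
Coupled-Always (coin _ _ c d) k (p , q) = Coupled-Always c k p , Coupled-Always d k q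

>>=-congᴬ : ∀ {A B : Set} {P : A → Set} (d : Dist A) {f g : A → Dist B} → Always P d →
            (∀ x → P x → f x ≡ g x) → (d >>= f) ≡ (d >>= g)
>>=-congᴬ (pure x)       p       k = k x p
>>=-congᴬ (coin a b x y) (p , q) k = cong₂ (coin a b) (>>=-congᴬ x p k) (>>=-congᴬ y q k)

Always->>=⁻ : ∀ {A B : Set} {P : B → Set} (d : Dist A) {f : A → Dist B} → Always P (d >>= f) →
  Always (λ x → Always P (f x)) d
Always->>=⁻ (pure x)       p       = p
Always->>=⁻ (coin _ _ x y) (p , q) = Always->>=⁻ x p , Always->>=⁻ y q

infix 4 _≗ₘ_
_≗ₘ_ : Memory → Memory → Set
σ ≗ₘ τ = ∀ a is → σ a is ≡ τ a is

write-same : ∀ a is v σ → write a is v σ a is ≡ v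
write-same a is v σ
  rewrite dec-true ((a ℕ.≟ a) ×-dec List.≡-dec ℕ._≟_ is is) (refl , refl) = refl

write-array : ∀ {a b} is v σ js → a ≢ b → write a is v σ b js ≡ σ b js
write-array {a} {b} is v σ js a≢b
  rewrite dec-false ((a ℕ.≟ b) ×-dec List.≡-dec ℕ._≟_ is js) (a≢b ∘ proj₁) = refl

write-address : ∀ a {is js} v σ b → is ≢ js → write a is v σ b js ≡ σ b js
write-address a {is} {js} v σ b is≢js
  rewrite dec-false ((a ℕ.≟ b) ×-dec List.≡-dec ℕ._≟_ is js) (is≢js ∘ proj₂) = refl

write-cong : ∀ a is v {σ τ} → σ ≗ₘ τ → write a is v σ ≗ₘ write a is v τ
write-cong a is v σ≗τ b js with does ((a ℕ.≟ b) ×-dec List.≡-dec ℕ._≟_ is js)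
... | true  = refl
... | false = σ≗τ b js

module Run (W : ℕ) {{W≢0 : NonZero W}} where

  open WordRAM W {{W≢0}} public

  mutual
    eval-cong : ∀ {σ τ} → σ ≗ₘ τ → ∀ e → eval σ e ≡ eval τ e
    eval-cong σ≗τ (lit c)     = refl
    eval-cong {σ} {τ} σ≗τ (read a es) = trans (σ≗τ a (evals σ es)) (cong (τ a) (evals-cong σ≗τ es))
    eval-cong σ≗τ (op o d e)  = cong₂ (λ x y → ⟦ o ⟧ x y ℕ.% W) (eval-cong σ≗τ d) (eval-cong σ≗τ e)

    evals-cong : ∀ {σ τ} → σ ≗ₘ τ → ∀ es → evals σ es ≡ evals τ es
    evals-cong σ≗τ []       = refl
    evals-cong σ≗τ (e ∷ es) = cong₂ _∷_ (eval-cong σ≗τ e) (evals-cong σ≗τ es)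

  length-evals : ∀ σ es → length (evals σ es) ≡ length es
  length-evals σ []       = refl
  length-evals σ (e ∷ es) = cong suc (length-evals σ es)

  -- With the outcome of the test as a parameter, a single value can drive both the compiled jump
  -- and the jump of the simulated run.
  branch : ℕ → Code → Code → Code
  branch zero    P Q = Q
  branch (suc _) P Q = P

  step-ifElse : ∀ {m} e P Q K σ → eval σ e ≡ m → step (ifElse e P Q) K σ ≡ pure (branch m P Q ++ K , σ)
  step-ifElse e P Q K σ refl with eval σ e
  ... | zero  = refl
  ... | suc _ = refl

  step-while : ∀ {m} e P K σ → eval σ e ≡ m →
    step (while e P) K σ ≡ pure (branch m (P ++ while e P ∷ []) [] ++ K , σ)
  step-while e P K σ refl with eval σ e
  ... | zero  = refl
  ... | suc _ = cong (λ K → pure (K , σ)) (sym (List.++-assoc P (while e P ∷ []) K))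

  infix 4 _≗ᶜ_
  _≗ᶜ_ : Config → Config → Set
  c ≗ᶜ d = proj₁ c ≡ proj₁ d × proj₂ c ≗ₘ proj₂ d

  write-cong₂ : ∀ a {is js v w σ τ} → is ≡ js → v ≡ w → σ ≗ₘ τ → write a is v σ ≗ₘ write a js w τ
  write-cong₂ a {is} {v = v} refl refl σ≗τ = write-cong a is v σ≗τ

  step-cong : ∀ S K {σ τ} → σ ≗ₘ τ → Coupled _≗ᶜ_ (step S K σ) (step S K τ)
  step-cong (assign a es e) K σ≗τ = pure (refl , write-cong₂ a (evals-cong σ≗τ es) (eval-cong σ≗τ e) σ≗τ)
  step-cong (flip a es d e) K {σ} {τ} σ≗τ rewrite eval-cong σ≗τ d | eval-cong σ≗τ e =
    coin (eval τ d) (eval τ e)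
      (pure (refl , write-cong₂ a (evals-cong σ≗τ es) refl σ≗τ))
      (pure (refl , write-cong₂ a (evals-cong σ≗τ es) refl σ≗τ))
  step-cong (ifElse e P Q) K {σ} {τ} σ≗τ
    rewrite step-ifElse e P Q K σ refl | step-ifElse e P Q K τ refl | eval-cong σ≗τ e = pure (refl , σ≗τ)
  step-cong (while e P) K {σ} {τ} σ≗τ
    rewrite step-while e P K σ refl | step-while e P K τ refl | eval-cong σ≗τ e = pure (refl , σ≗τ)

  run-cong : ∀ t K {σ τ} → σ ≗ₘ τ → Coupled _≗ᶜ_ (run t (K , σ)) (run t (K , τ))
  run-cong t       []      σ≗τ = pure (refl , σ≗τ)
  run-cong zero    (S ∷ K) σ≗τ = pure (refl , σ≗τ)
  run-cong (suc t) (S ∷ K) σ≗τ = Coupled->>= (step-cong S K σ≗τ) λ { {K , _} (refl , σ≗τ) → run-cong t K σ≗τ }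

  halts-cong : ∀ t K {σ τ} → σ ≗ₘ τ → HaltsWithin t (K , σ) → HaltsWithin t (K , τ)
  halts-cong t K σ≗τ = Coupled-Always (run-cong t K σ≗τ) λ { (refl , _) p → p }

  𝔼-run-cong : ∀ t K {σ τ} (h : ℕ → ℚ) a is → σ ≗ₘ τ →
    𝔼 (run t (K , σ)) (λ c → h (proj₂ c a is)) ≡ 𝔼 (run t (K , τ)) (λ c → h (proj₂ c a is))
  𝔼-run-cong t K h a is σ≗τ = Coupled-𝔼 (run-cong t K σ≗τ) λ (_ , σ≗τ) → cong h (σ≗τ a is)

  run-mono : ∀ {t t′} K σ → t ℕ.≤ t′ → HaltsWithin t (K , σ) → run t (K , σ) ≡ run t′ (K , σ)
  run-mono {t} {t′} []      σ le       p = refl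
  run-mono          (S ∷ K) σ (s≤s le) p =
    >>=-congᴬ (step S K σ) (Always->>=⁻ (step S K σ) p) λ (K , σ) → run-mono K σ le

  -- A quantitative form of total correctness. The rules below work backwards: a bound for the
  -- continuation, from every state it may be entered in, yields a bound for the code in front of
  -- it.
  record Bounded (Φ : Memory → ℚ) (t : ℕ) (c : Config) (v : ℚ) : Set where
    constructor _,_
    field
      halted : HaltsWithin t c
      bound  : 𝔼 (run t c) (Φ ∘ proj₂) ℚ.≤ v

  open Bounded public

  module _ {Φ : Memory → ℚ} where

    bounded-done : ∀ {t σ} → Bounded Φ t ([] , σ) (Φ σ)
    bounded-done = refl , ℚ.≤-refl

    bounded-weaken : ∀ {t t′ c v} → t ℕ.≤ t′ → Bounded Φ t c v → Bounded Φ t′ c v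
    bounded-weaken {c = K , σ} le (p , b) =
      subst (Always _) (run-mono K σ le p) p , subst (λ d → 𝔼 d _ ℚ.≤ _) (run-mono K σ le p) b

    bounded-≤ : ∀ {t c v w} → v ℚ.≤ w → Bounded Φ t c v → Bounded Φ t c w
    bounded-≤ v≤w (p , b) = p , ℚ.≤-trans b v≤w

    bounded-≡ : ∀ {t c v w} → v ≡ w → Bounded Φ t c v → Bounded Φ t c w
    bounded-≡ refl g = g

    bounded-cost : ∀ {t t′ c v} → t ≡ t′ → Bounded Φ t c v → Bounded Φ t′ c v
    bounded-cost refl g = g

    bounded-step : ∀ {t S K σ c v} → step S K σ ≡ pure c → Bounded Φ t c v → Bounded Φ (suc t) (S ∷ K , σ) v
    bounded-step {t} {S} {K} {σ} pf (p , b) =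
      subst (λ d → Always _ (d >>= run t)) (sym pf) p , subst (λ d → 𝔼 (d >>= run t) _ ℚ.≤ _) (sym pf) b

    bounded-flip : ∀ {t a es d e K σ v w} →
      Bounded Φ t (K , write a (evals σ es) 1 σ) v → Bounded Φ t (K , write a (evals σ es) 0 σ) w →
      Bounded Φ (suc t) (flip a es d e ∷ K , σ)
        (bias (eval σ d) (eval σ e) ℚ.* v ℚ.+ bias (eval σ e) (eval σ d) ℚ.* w)
    bounded-flip {d = d} {e} {σ = σ} (p , b) (q , c) = (p , q) , mix-mono (eval σ d) (eval σ e) b c

-- The compiled program

double-injective : ∀ {m n} → m + m ≡ n + n → m ≡ n
double-injective {zero}  {zero}  pf = refl
double-injective {suc m} {suc n} pf = cong suc (double-injective (ℕ.suc-injective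
  (trans (sym (ℕ.+-suc m m)) (trans (ℕ.suc-injective pf) (ℕ.+-suc n n)))))

double≢1+double : ∀ {m n} → m + m ≢ suc (n + n)
double≢1+double {suc m} {zero}  pf with () ← trans (sym (ℕ.+-suc m m)) (ℕ.suc-injective pf)
double≢1+double {suc m} {suc n} pf = double≢1+double {m} {n} (ℕ.suc-injective
  (trans (sym (ℕ.+-suc m m)) (trans (ℕ.suc-injective pf) (cong suc (ℕ.+-suc n n)))))

abstract
  -- The pairing 2^c (2a + 1) - 1. Only its injectivity is used outside, so it is kept abstract. The
  -- summand 3 in `cell` remains visible and separates its values from the arrays 0, 1 and 2 by
  -- computation.
  pair : ℕ → ℕ → ℕ
  pair zero    a = a + a
  pair (suc c) a = suc (pair c a + pair c a)

  pair-injective : ∀ {c a c′ a′} → pair c a ≡ pair c′ a′ → c ≡ c′ × a ≡ a′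
  pair-injective {zero}  {a} {zero}   {a′} pf = refl , double-injective pf
  pair-injective {zero}  {a} {suc c′} {a′} pf = contradiction pf (double≢1+double {a} {pair c′ a′})
  pair-injective {suc c} {a} {zero}   {a′} pf = contradiction (sym pf) (double≢1+double {a′} {pair c a})
  pair-injective {suc c} {a} {suc c′} {a′} pf with pair-injective {c} {a} {c′}
    (double-injective (ℕ.suc-injective pf))
  ... | refl , a≡a′ = refl , a≡a′

-- The arrays 0, 1, 2 keep their role; the others are split into channels:
-- channel 0 marks the sampled input cells, channel 1 holds the sampled bits,
-- channel 2 the address being accessed, and channel 3 + c the arrays of run c.
cell : ℕ → ℕ → ℕ
cell c a = 3 + pair c a

cell-injective : ∀ {c a c′ a′} → cell c a ≡ cell c′ a′ → c ≡ c′ × a ≡ a′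
cell-injective pf = pair-injective (ℕ.suc-injective (ℕ.suc-injective (ℕ.suc-injective pf)))

cell-≢ : ∀ {c a c′ a′} → c ≢ c′ → cell c a ≢ cell c′ a′
cell-≢ c≢c′ = c≢c′ ∘ proj₁ ∘ cell-injective

touchedA : ℕ
touchedA = cell 0 0

bitA addrA : ℕ → ℕ
bitA  = cell 1
addrA = cell 2

runA : ℕ → ℕ → ℕ
runA c = cell (3 + c)

-- The literal 2 would denote 0 in words modulo 2.
xorExpr : Expr → Expr → Expr
xorExpr x y = op eq (op eq x y) (lit 0)

addrExprs : ℕ → ℕ → List Expr
addrExprs i zero    = []
addrExprs i (suc m) = read (addrA i) [] ∷ addrExprs (suc i) m

increasingExpr : List Expr → Expr
increasingExpr []           = lit 1
increasingExpr (x ∷ [])     = op lt x (read 0 [])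
increasingExpr (x ∷ y ∷ ys) = op mul (op lt x y) (increasingExpr (y ∷ ys))

combination : ∀ {D} → ℕ → Expr → Vec Bool D → Expr
combination i e []          = e
combination i e (true  ∷ U) = combination (suc i) (xorExpr e (read (bitA i) [])) U
combination i e (false ∷ U) = combination (suc i) e U

flips : ℕ → ℕ → Code → Code
flips i zero    R = R
-- A coin weighs its two sides by the successors of its arguments, so two zeros make it fair.
flips i (suc m) R = flip (bitA i) [] (lit 0) (lit 0) ∷ flips (suc i) m R

flips-++ : ∀ i m R X → flips i m R ++ X ≡ flips i m (R ++ X)
flips-++ i zero    R X = refl
flips-++ i (suc m) R X = cong (_ ∷_) (flips-++ (suc i) m R X)

mutual
  rename : ℕ → Expr → Expr
  rename c (lit k)     = lit k
  rename c (read a es) = read (runA c a) (renames c es)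
  rename c (op o d e)  = op o (rename c d) (rename c e)

  renames : ℕ → List Expr → List Expr
  renames c []       = []
  renames c (e ∷ es) = rename c e ∷ renames c es

length-renames : ∀ c es → length (renames c es) ≡ length es
length-renames c []       = refl
length-renames c (e ∷ es) = cong suc (length-renames c es)

-- With the address held in scratch cells, `touch` can be the same code for every access, and
-- stamping, which writes only to run arrays, cannot disturb the address.
load : ℕ → List Expr → Code → Code
load i []       R = R
load i (e ∷ es) R = assign (addrA i) [] e ∷ load (suc i) es R

load-++ : ∀ i es R X → load i es R ++ X ≡ load i es (R ++ X)
load-++ i []       R X = refl
load-++ i (e ∷ es) R X = cong (_ ∷_) (load-++ (suc i) es R X)

module Compile (s D : ℕ) (jobs : List (Vec Bool D)) where

  address : List Expr
  address = addrExprs 0 s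

  -- A run is numbered by the number of jobs after it, so that a suffix of the list keeps its
  -- numbering. A sampled cell is entered into the input arrays of all runs at once; the `D` bits
  -- themselves can then be discarded and their scratch cells reused.
  stamps : List (Vec Bool D) → Code → Code
  stamps []       R = R
  stamps (U ∷ us) R =
    assign (runA (length us) 1) address (combination 0 (read 1 address) U) ∷ stamps us R

  stamps-++ : ∀ us R X → stamps us R ++ X ≡ stamps us (R ++ X)
  stamps-++ []       R X = refl
  stamps-++ (U ∷ us) R X = cong (_ ∷_) (stamps-++ us R X)

  sample : Code → Code
  sample R = flips 0 D (stamps jobs (assign touchedA address (lit 1) ∷ R))

  sample-++ : ∀ R X → sample R ++ X ≡ sample (R ++ X)
  sample-++ R X = trans (flips-++ 0 D _ X) (cong (flips 0 D) (stamps-++ jobs _ X))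

  -- The product of 0/1 words serves as conjunction. Both factors are always evaluated, which is
  -- harmless because every address can be read.
  touchCond : Expr
  touchCond = op mul (increasingExpr address) (op eq (read touchedA address) (lit 0))

  touch : Stmt
  touch = ifElse touchCond (sample []) []

  touchCost : ℕ
  touchCost = suc (D + (length jobs + 1))

  -- The array and the length of the tuple are visible in the code, so accesses that cannot meet an
  -- input cell are dismissed at compile time. Whether the tuple is a hyperedge is left to `touch`.
  guard : ℕ → ℕ → List Expr → Code → Code
  guard c a es R =
    if does (a ℕ.≟ 1) ∧ does (length es ℕ.≟ s) then load 0 (renames c es) (touch ∷ R) else R

  guard-++ : ∀ c a es R X → guard c a es R ++ X ≡ guard c a es (R ++ X)
  guard-++ c a es R X with does (a ℕ.≟ 1) ∧ does (length es ℕ.≟ s)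
  ... | true  = load-++ 0 (renames c es) (touch ∷ R) X
  ... | false = refl

  mutual
    -- Code that samples the input cells read by the expression.
    pre : ℕ → Expr → Code → Code
    pre c (lit k)     R = R
    pre c (read a es) R = pres c es (guard c a es R)
    pre c (op o d e)  R = pre c d (pre c e R)

    pres : ℕ → List Expr → Code → Code
    pres c []       R = R
    pres c (e ∷ es) R = pre c e (pres c es R)

  mutual
    pre-++ : ∀ c e R X → pre c e R ++ X ≡ pre c e (R ++ X)
    pre-++ c (lit k)     R X = refl
    pre-++ c (read a es) R X = trans (pres-++ c es _ X) (cong (pres c es) (guard-++ c a es R X))
    pre-++ c (op o d e)  R X = trans (pre-++ c d _ X) (cong (pre c d) (pre-++ c e R X))

    pres-++ : ∀ c es R X → pres c es R ++ X ≡ pres c es (R ++ X)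
    pres-++ c []       R X = refl
    pres-++ c (e ∷ es) R X = trans (pre-++ c e _ X) (cong (pre c e) (pres-++ c es R X))

  mutual
    compile : ℕ → Code → Code → Code
    compile c []      R = R
    compile c (S ∷ K) R = compileStmt c S (compile c K R)

    compileStmt : ℕ → Stmt → Code → Code
    -- The destination is sampled as if it were read. Otherwise a later sampling of that cell,
    -- possibly on behalf of another run, would destroy what this run has written there.
    compileStmt c (assign a es e) R =
      pre c e (pre c (read a es) (assign (runA c a) (renames c es) (rename c e) ∷ R))
    compileStmt c (flip a es d e) R =
      pre c d (pre c e (pre c (read a es) (flip (runA c a) (renames c es) (rename c d) (rename c e) ∷ R)))
    compileStmt c (ifElse e P Q) R = pre c e (ifElse (rename c e) (compile c P []) (compile c Q []) ∷ R)
    -- The condition is evaluated anew after every round and may then read other input cells, hence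
    -- the second `pre` at the end of the body.
    compileStmt c (while e P)    R = pre c e (while (rename c e) (compile c P (pre c e [])) ∷ R)

  compileStmt-++ : ∀ c S R X → compileStmt c S R ++ X ≡ compileStmt c S (R ++ X)
  compileStmt-++ c (assign a es e) R X =
    trans (pre-++ c e _ X) (cong (pre c e) (pre-++ c (read a es) _ X))
  compileStmt-++ c (flip a es d e) R X =
    trans (pre-++ c d _ X) (cong (pre c d) (trans (pre-++ c e _ X) (cong (pre c e) (pre-++ c (read a es) _ X))))
  compileStmt-++ c (ifElse e P Q)  R X = pre-++ c e _ X
  compileStmt-++ c (while e P)     R X = pre-++ c e _ X

  compile-++ : ∀ c K R X → compile c K R ++ X ≡ compile c K (R ++ X)
  compile-++ c []      R X = refl
  compile-++ c (S ∷ K) R X =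
    trans (compileStmt-++ c S _ X) (cong (compileStmt c S) (compile-++ c K R X))

  compile-append : ∀ c K K′ R → compile c (K ++ K′) R ≡ compile c K (compile c K′ R)
  compile-append c []      K′ R = refl
  compile-append c (S ∷ K) K′ R = cong (compileStmt c S) (compile-append c K K′ R)

  mutual
    preCost : Expr → ℕ
    preCost (lit k)     = 0
    preCost (read a es) = presCost es + (s + touchCost)
    preCost (op o d e)  = preCost d + preCost e

    presCost : List Expr → ℕ
    presCost []       = 0
    presCost (e ∷ es) = preCost e + presCost es

  stepCost : Stmt → ℕ
  stepCost (assign a es e) = preCost e + (preCost (read a es) + 1)
  stepCost (flip a es d e) = preCost d + (preCost e + (preCost (read a es) + 1))
  stepCost (ifElse e P Q)  = preCost e + 1
  stepCost (while e P)     = preCost e + 1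

  mutual
    -- The sum over all statements, nested ones included, is a crude substitute for the maximal cost
    -- of simulating one step.
    totalCost : Code → ℕ
    totalCost []      = 0
    totalCost (S ∷ K) = stmtCost S + totalCost K

    stmtCost : Stmt → ℕ
    stmtCost (assign a es e) = stepCost (assign a es e)
    stmtCost (flip a es d e) = stepCost (flip a es d e)
    stmtCost (ifElse e P Q)  = stepCost (ifElse e P Q) + (totalCost P + totalCost Q)
    stmtCost (while e P)     = stepCost (while e P) + totalCost P

  mutual
    -- Unrolling a loop duplicates code and would increase a sum of costs. A bound on each statement
    -- separately survives it.
    Within : ℕ → Code → Set
    Within C []      = ⊤
    Within C (S ∷ K) = StmtWithin C S × Within C K

    StmtWithin : ℕ → Stmt → Set
    StmtWithin C (assign a es e) = stepCost (assign a es e) ≤ C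
    StmtWithin C (flip a es d e) = stepCost (flip a es d e) ≤ C
    StmtWithin C (ifElse e P Q)  = preCost e + 1 ≤ C × Within C P × Within C Q
    StmtWithin C (while e P)     = preCost e + 1 ≤ C × Within C P

  mutual
    within : ∀ {C} K → totalCost K ≤ C → Within C K
    within []      le = tt
    within (S ∷ K) le = stmtWithin S (ℕ.m+n≤o⇒m≤o _ le) , within K (ℕ.m+n≤o⇒n≤o (stmtCost S) le)

    stmtWithin : ∀ {C} S → stmtCost S ≤ C → StmtWithin C S
    stmtWithin (assign a es e) le = le
    stmtWithin (flip a es d e) le = le
    stmtWithin (ifElse e P Q)  le =
      ℕ.m+n≤o⇒m≤o (preCost e + 1) le ,
      within P (ℕ.m+n≤o⇒m≤o _ (ℕ.m+n≤o⇒n≤o (preCost e + 1) le)) ,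
      within Q (ℕ.m+n≤o⇒n≤o (totalCost P) (ℕ.m+n≤o⇒n≤o (preCost e + 1) le))
    stmtWithin (while e P)     le =
      ℕ.m+n≤o⇒m≤o (preCost e + 1) le , within P (ℕ.m+n≤o⇒n≤o (preCost e + 1) le)

  within-++ : ∀ {C} K {K′} → Within C K → Within C K′ → Within C (K ++ K′)
  within-++ []      w       w′ = w′
  within-++ (S ∷ K) (v , w) w′ = v , within-++ K w w′

  program : List (Vec Bool D) → Code → Code
  program []       K = []
  program (U ∷ us) K =
    -- Only the size has to be copied: input cells are entered when sampled, and all other cells of
    -- the run start at 0 anyway.
    assign (runA (length us) 0) [] (read 0 []) ∷
    compile (length us) K
      (assign 2 [] (xorExpr (read 2 []) (read (runA (length us) 2) [])) ∷ program us K)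

-- Simulation of a run

module Eval (W : ℕ) {{W≢0 : NonZero W}} (1<W : 1 ℕ.< W) where

  open Run W {{W≢0}} public

  bit-%W : ∀ b → bit b % W ≡ bit b
  bit-%W true  = m<n⇒m%n≡m 1<W
  bit-%W false = m<n⇒m%n≡m (ℕ.<-trans (s≤s z≤n) 1<W)

  -- Addition in 𝔽₂ on bits; the result is a bit even if a run has output some other word.
  xorℕ : ℕ → ℕ → ℕ
  xorℕ x y = bit (bit (x ≡ᵇ y) ≡ᵇ 0)

  xorℕ-bit : ∀ a b → xorℕ (bit a) (bit b) ≡ bit (a xor b)
  xorℕ-bit true  true  = refl
  xorℕ-bit true  false = refl
  xorℕ-bit false true  = refl
  xorℕ-bit false false = refl

  eval-xorExpr : ∀ σ x y → eval σ (xorExpr x y) ≡ xorℕ (eval σ x) (eval σ y)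
  eval-xorExpr σ x y rewrite bit-%W (eval σ x ≡ᵇ eval σ y) | bit-%W false =
    bit-%W (bit (eval σ x ≡ᵇ eval σ y) ≡ᵇ 0)

  eval-mul : ∀ σ x y {a b} → eval σ x ≡ bit a → eval σ y ≡ bit b → eval σ (op mul x y) ≡ bit (a ∧ b)
  eval-mul σ x y {a} {b} pf pf′ rewrite pf | pf′ = trans (cong (_% W) (lem a b)) (bit-%W (a ∧ b))
    where
    lem : ∀ a b → bit a * bit b ≡ bit (a ∧ b)
    lem true  b = ℕ.+-identityʳ (bit b)
    lem false b = refl

  eval-increasingExpr : ∀ σ {n} es → σ 0 [] ≡ n → eval σ (increasingExpr es) ≡ bit (increasing n (evals σ es))
  eval-increasingExpr σ []           refl = bit-%W true
  eval-increasingExpr σ (x ∷ [])     refl = bit-%W (eval σ x <ᵇ σ 0 [])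
  eval-increasingExpr σ (x ∷ y ∷ ys) n≡   = eval-mul σ (op lt x y) (increasingExpr (y ∷ ys))
    (bit-%W (eval σ x <ᵇ eval σ y)) (eval-increasingExpr σ (y ∷ ys) n≡)

  BitsAt : ∀ {m} → ℕ → Vec Bool m → Memory → Set
  BitsAt i []      σ = ⊤
  BitsAt i (b ∷ t) σ = σ (bitA i) [] ≡ bit b × BitsAt (suc i) t σ

  BitsAt-cong : ∀ {m} i (t : Vec Bool m) {σ τ} → (∀ j → τ (bitA j) [] ≡ σ (bitA j) []) →
    BitsAt i t σ → BitsAt i t τ
  BitsAt-cong i []      same tt       = tt
  BitsAt-cong i (b ∷ t) same (pf , r) = trans (same i) pf , BitsAt-cong (suc i) t same r

  eval-combination : ∀ {m} i e (U t : Vec Bool m) {σ b} → eval σ e ≡ bit b → BitsAt i t σ →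
                     eval σ (combination i e U) ≡ bit (b xor (U ∙ t))
  eval-combination i e []          []      {b = b} e≡ tt = trans e≡ (cong bit (sym (xor-identityʳ b)))
  eval-combination i e (true ∷ U)  (c ∷ t) {σ} {b} e≡ (c≡ , r) =
    trans (eval-combination (suc i) _ U t
            (trans (eval-xorExpr σ e (read (bitA i) [])) (trans (cong₂ xorℕ e≡ c≡) (xorℕ-bit b c))) r)
          (cong bit (xor-assoc b c (U ∙ t)))
  eval-combination i e (false ∷ U) (c ∷ t) e≡ (_ , r) = eval-combination (suc i) e U t e≡ r

  evals-addrExprs-cong : ∀ i m {σ τ} → (∀ j → τ (addrA j) [] ≡ σ (addrA j) []) →
                         evals τ (addrExprs i m) ≡ evals σ (addrExprs i m)
  evals-addrExprs-cong i zero    same = refl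
  evals-addrExprs-cong i (suc m) same = cong₂ _∷_ (same i) (evals-addrExprs-cong (suc i) m same)

  channel : ℕ → Memory → Memory
  channel c σ a = σ (runA c a)

  mutual
    eval-rename : ∀ c σ e → eval σ (rename c e) ≡ eval (channel c σ) e
    eval-rename c σ (lit k)     = refl
    eval-rename c σ (read a es) = cong (σ (runA c a)) (evals-renames c σ es)
    eval-rename c σ (op o d e)  = cong₂ (λ x y → ⟦ o ⟧ x y % W) (eval-rename c σ d) (eval-rename c σ e)

    evals-renames : ∀ c σ es → evals σ (renames c es) ≡ evals (channel c σ) es
    evals-renames c σ []       = refl
    evals-renames c σ (e ∷ es) = cong₂ _∷_ (eval-rename c σ e) (evals-renames c σ es)

  -- The frame condition of `flips` and `load`, which fill a channel in increasing order: what has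
  -- been written below `i` is final.
  Off : ℕ → ℕ → Memory → Memory → Set
  Off c i σ τ = ∀ a is → (∀ j → i ≤ j → a ≢ cell c j) → τ a is ≡ σ a is

  off-write : ∀ {c i v σ τ} → Off c (suc i) (write (cell c i) [] v σ) τ → Off c i σ τ
  off-write {c} {i} {v} {σ} off a is a≢ =
    trans (off a is (λ j i<j → a≢ j (ℕ.<⇒≤ i<j))) (write-array [] v σ is (λ pf → a≢ i ℕ.≤-refl (sym pf)))

  off-here : ∀ {c i v σ τ} → Off c (suc i) (write (cell c i) [] v σ) τ → τ (cell c i) [] ≡ v
  off-here {c} {i} {v} {σ} off = trans
    (off (cell c i) [] (λ j i<j pf → ℕ.<-irrefl (proj₂ (cell-injective {c} {i} {c} {j} pf)) i<j))
    (write-same (cell c i) [] v σ)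

  module _ {Φ : Memory → ℚ} where

    bounded-flips : ∀ i m {R t τ} {φ : Vec Bool m → ℚ} →
      (∀ u {τ′} → BitsAt i u τ′ → Off 1 i τ τ′ → Bounded Φ t (R , τ′) (φ u)) →
      Bounded Φ (m + t) (flips i m R , τ) (𝔼 (bits m) φ)
    bounded-flips i zero    k = k [] tt (λ a is _ → refl)
    bounded-flips i (suc m) {R} {t} {τ} {φ} k = bounded-≡ value (bounded-flip
      (bounded-flips (suc i) m {φ = φ ∘ (true ∷_)}
        (λ u at off → k (true ∷ u) (off-here {1} {i} off , at) (off-write {1} {i} off)))
      (bounded-flips (suc i) m {φ = φ ∘ (false ∷_)}
        (λ u at off → k (false ∷ u) (off-here {1} {i} off , at) (off-write {1} {i} off))))
      where
      value : bias (0 % W) (0 % W) ℚ.* 𝔼 (bits m) (φ ∘ (true ∷_)) ℚ.+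
              bias (0 % W) (0 % W) ℚ.* 𝔼 (bits m) (φ ∘ (false ∷_))
              ≡ 𝔼 (bits (suc m)) φ
      value rewrite bit-%W false = sym (𝔼-bits-suc m φ)

    bounded-load : ∀ i c es {R t τ v} →
      (∀ {τ′} → Off 2 i τ τ′ → evals τ′ (addrExprs i (length es)) ≡ evals τ (renames c es) →
        Bounded Φ t (R , τ′) v) →
      Bounded Φ (length es + t) (load i (renames c es) R , τ) v
    bounded-load i c []       k = k (λ a is _ → refl) refl
    bounded-load i c (e ∷ es) {R} {t} {τ} k = bounded-step refl (bounded-load (suc i) c es λ {τ′} off vs≡ →
      k (off-write {2} {i} off) (cong₂ _∷_ (off-here {2} {i} off) (trans vs≡ (unchanged es))))
      where
      unchanged : ∀ es → evals (write (addrA i) [] (eval τ (rename c e)) τ) (renames c es) ≡ evals τ (renames c es)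
      unchanged es = trans (evals-renames c _ es) (trans
        (evals-cong (λ a is → write-array {addrA i} [] _ τ is (cell-≢ {2} {i} {3 + c} {a} λ ())) es)
        (sym (evals-renames c τ es)))

-- Partly sampled states and the memory seen by a simulated run

module Simulation (s D : ℕ) (jobs : List (Vec Bool D)) (n : ℕ) (g : Vec Bool (#edges n s))
                  (W : ℕ) {{W≢0 : NonZero W}} (1<W : 1 ℕ.< W) (Φ : Memory → ℚ) where

  open Compile s D jobs public
  open Eval W {{W≢0}} 1<W public

  private
    N : ℕ
    N = #edges n s

  vtx : Fin N → List ℕ
  vtx = vertices {n} {s}

  unsampled : Partial D N → Fin N → Maybe (Fin N)
  unsampled p i = maybe′ (λ _ → nothing) (just i) (lookup p i)

  pending : Partial D N → List ℕ → Maybe (Fin N)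
  pending p vs = maybe′ (unsampled p) nothing (findEdge n s vs)

  pending-vertices : ∀ p i → pending p (vtx i) ≡ unsampled p i
  pending-vertices p i rewrite findEdge-vertices n s i = refl

  pending-length : ∀ p vs → length vs ≢ s → pending p vs ≡ nothing
  pending-length p vs ≢s with findEdge n s vs in pf
  ... | nothing = refl
  ... | just i  = contradiction (trans (cong length (sym (findEdge-just n s pf))) (length-vertices {n} {s} i)) ≢s

  inputCell : Maybe (Fin N) → Vec Bool N → ℕ → ℕ
  inputCell m x old = maybe′ (bit ∘ lookup x) old m

  -- The memory that the simulated run in channel c would see if the table
  -- were T: the input cells that are still pending are filled in from T.
  virtual : ℕ → Vec Bool D → Partial D N → Memory → Table D N → Memory
  virtual c U p τ T zero          vs = τ (runA c 0) vs
  virtual c U p τ T (suc zero)    vs = inputCell (pending p vs) (query g U T) (τ (runA c 1) vs)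
  virtual c U p τ T (suc (suc a)) vs = τ (runA c (suc (suc a))) vs

  virtual-cong : ∀ c U p {τ τ′} T → channel c τ′ ≗ₘ channel c τ → virtual c U p τ′ T ≗ₘ virtual c U p τ T
  virtual-cong c U p T same zero          vs = same 0 vs
  virtual-cong c U p T same (suc zero)    vs = cong (inputCell (pending p vs) (query g U T)) (same 1 vs)
  virtual-cong c U p T same (suc (suc a)) vs = same (suc (suc a)) vs

  virtual-read : ∀ c U p τ T a vs → (a ≡ 1 → pending p vs ≡ nothing) → virtual c U p τ T a vs ≡ τ (runA c a) vs
  virtual-read c U p τ T zero          vs settled = refl
  virtual-read c U p τ T (suc zero)    vs settled rewrite settled refl = refl
  virtual-read c U p τ T (suc (suc a)) vs settled = refl

  channel-write : ∀ c a is v τ → channel c (write (runA c a) is v τ) ≗ₘ write a is v (channel c τ)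
  channel-write c a is v τ b js = go (a ℕ.≟ b) (List.≡-dec ℕ._≟_ is js)
    where
    go : Dec (a ≡ b) → Dec (is ≡ js) → channel c (write (runA c a) is v τ) b js ≡ write a is v (channel c τ) b js
    go (yes refl) (yes refl) = trans (write-same (runA c a) is v τ) (sym (write-same a is v (channel c τ)))
    go (yes refl) (no is≢js) =
      trans (write-address (runA c a) v τ (runA c a) is≢js)
      (sym (write-address a v (channel c τ) a is≢js))
    go (no a≢b)   _          = trans
      (write-array is v τ js (λ pf → a≢b (proj₂ (cell-injective {3 + c} {a} {3 + c} {b} pf))))
      (sym (write-array is v (channel c τ) js a≢b))

  -- A value written to a pending input cell would be masked by the value filled in from `T`; the
  -- hypothesis excludes this.
  virtual-write : ∀ c U p τ T a is v → (a ≡ 1 → pending p is ≡ nothing) →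
    virtual c U p (write (runA c a) is v τ) T ≗ₘ write a is v (virtual c U p τ T)
  virtual-write c U p τ T a is v settled zero          js = channel-write c a is v τ 0 js
  virtual-write c U p τ T a is v settled (suc (suc b)) js = channel-write c a is v τ (suc (suc b)) js
  virtual-write c U p τ T a is v settled (suc zero)    js = go (a ℕ.≟ 1) (List.≡-dec ℕ._≟_ is js)
    where
    τ′ : Memory
    τ′ = write (runA c a) is v τ
    input-cong : ∀ {x y} → x ≡ y →
      inputCell (pending p js) (query g U T) x ≡ inputCell (pending p js) (query g U T) y
    input-cong = cong (inputCell (pending p js) (query g U T))
    go : Dec (a ≡ 1) → Dec (is ≡ js) → virtual c U p τ′ T 1 js ≡ write a is v (virtual c U p τ T) 1 js
    go (yes refl) (yes refl) = trans (virtual-read c U p τ′ T 1 is settled)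
      (trans (write-same (runA c 1) is v τ) (sym (write-same 1 is v (virtual c U p τ T))))
    go (yes refl) (no is≢js) = trans (input-cong (write-address (runA c 1) v τ (runA c 1) is≢js))
      (sym (write-address 1 v (virtual c U p τ T) 1 is≢js))
    go (no a≢1)   _          = trans
      (input-cong (write-array is v τ js (λ pf → a≢1 (proj₂ (cell-injective {3 + c} {a} {3 + c} {1} pf)))))
      (sym (write-array is v (virtual c U p τ T) js a≢1))

  record Invariant (p : Partial D N) (τ : Memory) : Set where
    field
      size    : τ 0 [] ≡ n
      input   : ∀ i → τ 1 (vtx i) ≡ bit (lookup g i)
      touched : ∀ i → τ touchedA (vtx i) ≡ bit (is-just (lookup p i))

  open Invariant public

  invariant-cong : ∀ {p τ τ′} → (∀ is → τ′ 0 is ≡ τ 0 is) → (∀ is → τ′ 1 is ≡ τ 1 is) →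
                   (∀ is → τ′ touchedA is ≡ τ touchedA is) → Invariant p τ → Invariant p τ′
  invariant-cong s0 s1 s3 inv = record
    { size    = trans (s0 []) (size inv)
    ; input   = λ i → trans (s1 (vtx i)) (input inv i)
    ; touched = λ i → trans (s3 (vtx i)) (touched inv i)
    }

  -- The possible effect of a part of the program on the sampled table and on
  -- the memory, where us are the jobs to be preserved.
  record Evolves (us : List (Vec Bool D)) (p : Partial D N) (τ : Memory) (p′ : Partial D N)
    (τ′ : Memory) : Set where
    field
      grows     : ∀ i {t} → lookup p i ≡ just t → lookup p′ i ≡ just t
      preserves : ∀ {pfx U us′} → us ≡ pfx ++ U ∷ us′ → ∀ {T} → T Extends p′ →
                  virtual (length us′) U p′ τ′ T ≗ₘ virtual (length us′) U p τ T
      result    : τ′ 2 [] ≡ τ 2 []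
      invariant : Invariant p′ τ′

    extends : ∀ {T : Table D N} → T Extends p′ → T Extends p
    extends {T} ext i pf = ext i (grows i pf)

    settles : ∀ vs → pending p vs ≡ nothing → pending p′ vs ≡ nothing
    settles vs pf with findEdge n s vs
    ... | nothing = refl
    ... | just i with lookup p i in p≡ | pf
    ...   | just t | _ rewrite grows i p≡ = refl

  open Evolves public

  evolves-refl : ∀ {us p τ} → Invariant p τ → Evolves us p τ p τ
  evolves-refl inv = record
    { grows = λ i pf → pf ; preserves = λ _ _ a is → refl ; result = refl ; invariant = inv }

  evolves-trans : ∀ {us p τ p′ τ′ p″ τ″} → Evolves us p τ p′ τ′ → Evolves us p′ τ′ p″ τ″ → Evolves us p τ p″ τ″
  evolves-trans ev ev′ = record
    { grows     = λ i pf → grows ev′ i (grows ev i pf)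
    ; preserves = λ dec {T} ext a is →
      trans (preserves ev′ dec {T} ext a is) (preserves ev dec {T} (extends ev′ {T} ext) a is)
    ; result    = trans (result ev′) (result ev)
    ; invariant = invariant ev′
    }

  evolves-suffix : ∀ {us p τ p′ τ′} pfx → jobs ≡ pfx ++ us → Evolves jobs p τ p′ τ′ → Evolves us p τ p′ τ′
  evolves-suffix pfx refl ev = record
    { grows     = grows ev
    ; preserves = λ { {pfx′} {U} {us′} refl → preserves ev (sym (List.++-assoc pfx pfx′ (U ∷ us′))) }
    ; result    = result ev
    ; invariant = invariant ev
    }

  evolves-cong : ∀ {us p τ τ′} → (∀ is → τ′ 0 is ≡ τ 0 is) → (∀ is → τ′ 1 is ≡ τ 1 is) → τ′ 2 [] ≡ τ 2 [] →
    (∀ is → τ′ touchedA is ≡ τ touchedA is) →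
    (∀ {pfx U us′} → us ≡ pfx ++ U ∷ us′ → channel (length us′) τ′ ≗ₘ channel (length us′) τ) →
    Invariant p τ → Evolves us p τ p τ′
  evolves-cong {p = p} s0 s1 s2 s3 sc inv = record
    { grows     = λ i pf → pf
    ; preserves = λ { {U = U} {us′ = us′} dec {T} _ → virtual-cong (length us′) U p T (sc dec) }
    ; result    = s2
    ; invariant = invariant-cong s0 s1 s3 inv
    }

  off-evolves : ∀ {us c p τ τ′} → c ≡ 1 ⊎ c ≡ 2 → Off c 0 τ τ′ → Invariant p τ → Evolves us p τ p τ′
  off-evolves {c = c} c≡ off = evolves-cong (λ is → off 0 is (λ _ _ ())) (λ is → off 1 is (λ _ _ ()))
    (off 2 [] (λ _ _ ())) (λ is → off touchedA is (λ j _ → cell-≢ {0} {0} {c} {j} (0≢ c≡)))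
    (λ { {us′ = us′} _ a is →
      off (runA (length us′) a) is (λ j _ → cell-≢ {3 + length us′} {a} {c} {j} (3+≢ c≡)) })
    where
    0≢ : ∀ {c} → c ≡ 1 ⊎ c ≡ 2 → 0 ≢ c
    0≢ (inj₁ refl) ()
    0≢ (inj₂ refl) ()
    3+≢ : ∀ {m c} → c ≡ 1 ⊎ c ≡ 2 → 3 + m ≢ c
    3+≢ (inj₁ refl) ()
    3+≢ (inj₂ refl) ()

  suffix-length : ∀ {us : List (Vec Bool D)} pfx {U us′} → us ≡ pfx ++ U ∷ us′ → length us′ ℕ.< length us
  suffix-length pfx {U} {us′} refl =
    subst (suc (length us′) ≤_) (sym (List.length-++ pfx)) (ℕ.m≤n+m _ (length pfx))

  -- The jobs in `us` have numbers below `length us`, so a run writing to its own channel cannot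
  -- affect those still to come.
  write-evolves : ∀ us {p τ} a is v → Invariant p τ → Evolves us p τ p (write (runA (length us) a) is v τ)
  write-evolves us {τ = τ} a is v = evolves-cong
    (λ js → write-array {runA (length us) a} {0} is v τ js λ ())
    (λ js → write-array {runA (length us) a} {1} is v τ js λ ())
    (write-array {runA (length us) a} {2} is v τ [] λ ())
    (λ js → write-array is v τ js (cell-≢ {3 + length us} {a} {0} {0} λ ()))
    (λ { {pfx} {us′ = us′} dec b js → write-array is v τ js (cell-≢ {3 + length us} {a} {3 + length us′} {b}
           (λ pf → ℕ.<-irrefl (sym (ℕ.+-cancelˡ-≡ 3 (length us) (length us′) pf)) (suffix-length pfx dec))) })

  write-at : ∀ a {is js v w} τ → is ≡ js → v ≡ w → write a is v τ a js ≡ w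
  write-at a {is} {v = v} τ refl refl = write-same a is v τ

  record Ready (vs : List ℕ) (b : Bool) (t : Vec Bool D) (τ : Memory) : Set where
    field
      bitsReady    : BitsAt 0 t τ
      addressReady : evals τ address ≡ vs
      inputReady   : τ 1 vs ≡ bit b

  open Ready

  ready-write : ∀ {vs b t τ} c is v → Ready vs b t τ → Ready vs b t (write (runA c 1) is v τ)
  ready-write {vs} {t = t} {τ} c is v r = record
    { bitsReady    = BitsAt-cong 0 t (λ j → write-array is v τ [] (cell-≢ {3 + c} {1} {1} {j} λ ())) (bitsReady r)
    ; addressReady =
      trans (evals-addrExprs-cong 0 s
      (λ j → write-array is v τ [] (cell-≢ {3 + c} {1} {2} {j} λ ())))
                           (addressReady r)
    ; inputReady   = trans (write-array {runA c 1} {1} is v τ vs λ ()) (inputReady r)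
    }

  record Stamped (us : List (Vec Bool D)) (vs : List ℕ) (val : Vec Bool D → ℕ) (τ τ′ : Memory) : Set where
    field
      new : ∀ {pfx U us′} → us ≡ pfx ++ U ∷ us′ → τ′ (runA (length us′) 1) vs ≡ val U
      old : ∀ a is → (∀ {c} → c ℕ.< length us → a ≢ runA c 1) ⊎ is ≢ vs → τ′ a is ≡ τ a is

  open Stamped

  bounded-stamps : ∀ us {vs b t τ R m v} → Ready vs b t τ →
    (∀ {τ′} → Ready vs b t τ′ → Stamped us vs (λ U → bit (b xor (U ∙ t))) τ τ′ → Bounded Φ m (R , τ′) v) →
    Bounded Φ (length us + m) (stamps us R , τ) v
  bounded-stamps [] r k = k r record { new = λ { {[]} () ; {_ ∷ _} () } ; old = λ _ _ _ → refl }
  bounded-stamps (U ∷ us) {vs} {b} {t} {τ} r k =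
    bounded-step refl (bounded-stamps us (ready-write l is v r) λ {τ′} r′ st → k r′ record
    -- The remaining stamps go to channels with numbers below `l` and leave this one intact.
    { new = λ { {[]} refl → trans (old st (runA l 1) vs (inj₁ λ c<l pf → ℕ.<-irrefl (same-channel pf) c<l))
                              (write-at (runA l 1) τ (addressReady r) value)
              ; {_ ∷ _} refl → new st refl }
    ; old = λ { a js (inj₁ a≢) → trans (old st a js (inj₁ (a≢ ∘ ℕ.m<n⇒m<1+n)))
                                   (write-array is v τ js (λ pf → a≢ ℕ.≤-refl (sym pf)))
              ; a js (inj₂ js≢) → trans (old st a js (inj₂ js≢))
                                   (write-address (runA l 1) v τ a
                                     (λ pf → js≢ (trans (sym pf) (addressReady r)))) }
    })
    where
    l : ℕ
    l = length us
    is : List ℕ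
    is = evals τ address
    v : ℕ
    v = eval τ (combination 0 (read 1 address) U)
    same-channel : ∀ {c} → runA l 1 ≡ runA c 1 → c ≡ l
    same-channel {c} pf = sym (ℕ.+-cancelˡ-≡ 3 l c (proj₁ (cell-injective {3 + l} {1} {3 + c} {1} pf)))
    value : v ≡ bit (b xor (U ∙ t))
    value = eval-combination 0 (read 1 address) U t
      (trans (cong (τ 1) (addressReady r)) (inputReady r)) (bitsReady r)

  lookup-query : ∀ U (T : Table D N) i → lookup (query g U T) i ≡ lookup g i xor (U ∙ lookup T i)
  lookup-query U T i = trans (Vec.lookup-zipWith _xor_ i g (Vec.map (U ∙_) T))
    (cong (lookup g i xor_) (Vec.lookup-map i (U ∙_) T))

  -- At the sampled cell, the value formerly filled in from `T` is replaced by a stored one. Both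
  -- are the same bit, because a table that extends the new partial table has row `t` there.
  sampled-evolves : ∀ {p τ τ′ i t} → lookup p i ≡ nothing → Invariant p τ →
    (∀ {pfx U us} → jobs ≡ pfx ++ U ∷ us → τ′ (runA (length us) 1) (vtx i) ≡ bit (lookup g i xor (U ∙ t))) →
    τ′ touchedA (vtx i) ≡ 1 →
    (∀ a is → a ≢ touchedA ⊎ is ≢ vtx i → (∀ j → a ≢ bitA j) → (∀ c → a ≢ runA c 1) ⊎ is ≢ vtx i →
      τ′ a is ≡ τ a is) →
    Evolves jobs p τ (p [ i ]≔ just t) τ′
  sampled-evolves {p} {τ} {τ′} {i} {t} p≡ inv new touched′ old′ = record
    { grows     = λ j pf → trans (Vec.lookup∘update′ (λ { refl → case-just (trans (sym pf) p≡) }) p (just t)) pf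
    ; preserves = λ {pfx} {U} {us} dec {T} ext → virt dec ext
    ; result    = old′ 2 [] (inj₁ λ ()) (λ _ ()) (inj₁ λ _ ())
    ; invariant = record
      { size    = trans (old′ 0 [] (inj₁ λ ()) (λ _ ()) (inj₁ λ _ ())) (size inv)
      ; input   = λ j → trans (old′ 1 (vtx j) (inj₁ λ ()) (λ _ ()) (inj₁ λ _ ())) (input inv j)
      ; touched = touched″
      }
    }
    where
    case-just : ∀ {u : Vec Bool D} {A : Set} → just u ≡ nothing → A
    case-just ()
    touched″ : ∀ j → τ′ touchedA (vtx j) ≡ bit (is-just (lookup (p [ i ]≔ just t) j))
    touched″ j with j Fin.≟ i
    ... | yes refl rewrite Vec.lookup∘update i p (just t) = touched′
    ... | no j≢i   rewrite Vec.lookup∘update′ j≢i p (just t) = trans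
      (old′ touchedA (vtx j) (inj₂ (j≢i ∘ vertices-injective {n} {s})) (λ j → cell-≢ {0} {0} {1} {j} λ ())
            (inj₁ λ c → cell-≢ {0} {0} {3 + c} {1} λ ()))
      (touched inv j)
    pending-other : ∀ is → is ≢ vtx i → pending (p [ i ]≔ just t) is ≡ pending p is
    pending-other is is≢ with findEdge n s is in pf
    ... | nothing = refl
    ... | just j  = cong (maybe′ (λ _ → nothing) (just j))
      (Vec.lookup∘update′ (λ { refl → is≢ (sym (findEdge-just n s pf)) }) p (just t))
    run-old : ∀ c a is → a ≢ 1 ⊎ is ≢ vtx i → τ′ (runA c a) is ≡ τ (runA c a) is
    run-old c a is ne = old′ (runA c a) is (inj₁ (cell-≢ {3 + c} {a} {0} {0} λ ()))
      (λ j → cell-≢ {3 + c} {a} {1} {j} λ ()) (lem ne)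
      where
      lem : a ≢ 1 ⊎ is ≢ vtx i → (∀ c′ → runA c a ≢ runA c′ 1) ⊎ is ≢ vtx i
      lem (inj₁ a≢)  = inj₁ λ c′ pf → a≢ (proj₂ (cell-injective {3 + c} {a} {3 + c′} {1} pf))
      lem (inj₂ is≢) = inj₂ is≢
    virt : ∀ {pfx U us} → jobs ≡ pfx ++ U ∷ us → ∀ {T} → T Extends (p [ i ]≔ just t) →
           virtual (length us) U (p [ i ]≔ just t) τ′ T ≗ₘ virtual (length us) U p τ T
    virt {us = us} dec ext zero          is = run-old (length us) 0 is (inj₁ λ ())
    virt {us = us} dec ext (suc (suc a)) is = run-old (length us) (suc (suc a)) is (inj₁ λ ())
    virt {U = U} {us} dec {T} ext (suc zero) is with List.≡-dec ℕ._≟_ is (vtx i)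
    ... | no is≢   =
      cong₂ (λ m → inputCell m (query g U T)) (pending-other is is≢)
      (run-old (length us) 1 is (inj₂ is≢))
    ... | yes refl rewrite pending-vertices (p [ i ]≔ just t) i | pending-vertices p i
                         | Vec.lookup∘update i p (just t) | p≡ =
      trans (new dec)
        (cong bit (trans
        (cong (λ u → lookup g i xor (U ∙ u)) (sym (ext i (Vec.lookup∘update i p (just t)))))
                                       (sym (lookup-query U T i))))

  eval-isZero : ∀ σ x → eval σ (op eq x (lit 0)) ≡ bit (eval σ x ≡ᵇ 0)
  eval-isZero σ x rewrite bit-%W false = bit-%W (eval σ x ≡ᵇ 0)

  eval-touchCond : ∀ {p τ vs} → Invariant p τ → evals τ address ≡ vs →
                   eval τ touchCond ≡ bit (increasing n vs ∧ (τ touchedA vs ≡ᵇ 0))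
  eval-touchCond {τ = τ} inv refl = eval-mul τ (increasingExpr address) (op eq (read touchedA address) (lit 0))
    (eval-increasingExpr τ address (size inv)) (eval-isZero τ (read touchedA address))

  -- Deferred decision: if the cell is pending, `𝔼-reveal` rewrites the expectation over completions
  -- as an average over the row drawn now, which is what the flips produce. In the other two cases,
  -- no hyperedge or already sampled, nothing is pending.
  bounded-touch : ∀ {p τ vs R m} {h : Table D N → ℚ} → Invariant p τ → evals τ address ≡ vs → length vs ≡ s →
    (∀ {p′ τ′} → Evolves jobs p τ p′ τ′ → pending p′ vs ≡ nothing → Bounded Φ m (R , τ′) (𝔼 (completions p′) h)) →
    Bounded Φ (touchCost + m) (touch ∷ R , τ) (𝔼 (completions p) h)
  bounded-touch {p} {τ} {vs} {R} {m} {h} inv addr len k with increasing n vs in inc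
  ... | false = bounded-weaken (ℕ.+-monoˡ-≤ m {1} {touchCost} (s≤s z≤n))
    (bounded-step (step-ifElse touchCond (sample []) [] R τ
                    (trans (eval-touchCond inv addr) (cong (λ b → bit (b ∧ (τ touchedA vs ≡ᵇ 0))) inc)))
      (k (evolves-refl inv) (cong (maybe′ (unsampled p) nothing) (findEdge-¬increasing n s vs inc))))
  ... | true with findEdge-increasing n s vs len inc
  ...   | i , found with findEdge-just n s found | lookup p i in p≡
  ...     | refl | just t = bounded-weaken (ℕ.+-monoˡ-≤ m {1} {touchCost} (s≤s z≤n))
    (bounded-step (step-ifElse touchCond (sample []) [] R τ
                    (trans (eval-touchCond inv addr) (cong₂ (λ b x → bit (b ∧ (x ≡ᵇ 0))) inc
                      (trans (touched inv i) (cong (bit ∘ is-just) p≡)))))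
      (k (evolves-refl inv) (trans (pending-vertices p i) (cong (maybe′ (λ _ → nothing) (just i)) p≡))))
  ...     | refl | nothing = bounded-step {S = touch}
    (trans (step-ifElse touchCond (sample []) [] R τ
             (trans (eval-touchCond inv addr) (cong₂ (λ b x → bit (b ∧ (x ≡ᵇ 0))) inc
                      (trans (touched inv i) (cong (bit ∘ is-just) p≡)))))
           (cong (λ K → pure (K , τ)) (sample-++ [] R)))
    (bounded-≡ (sym (𝔼-reveal p i h p≡))
      (bounded-cost (sym arith)
        (bounded-flips 0 D λ t {τ₂} bitsAt off →
          bounded-stamps jobs (ready t bitsAt off) λ {τ₃} r st →
            bounded-step {S = assign touchedA address (lit 1)} refl (k (final t off r st) settled))))
    where
    arith : D + (length jobs + 1) + m ≡ D + (length jobs + (1 + m))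
    arith = trans (ℕ.+-assoc D (length jobs + 1) m) (cong (D ℕ.+_) (ℕ.+-assoc (length jobs) 1 m))
    ready : ∀ t {τ₂} → BitsAt 0 t τ₂ → Off 1 0 τ τ₂ → Ready (vtx i) (lookup g i) t τ₂
    ready t bitsAt off = record
      { bitsReady    = bitsAt
      ; addressReady =
        trans (evals-addrExprs-cong 0 s
        (λ j → off (addrA j) [] (λ j′ _ → cell-≢ {2} {j} {1} {j′} λ ()))) addr
      ; inputReady   = trans (off 1 (vtx i) (λ _ _ ())) (input inv i)
      }
    settled : ∀ {t} → pending (p [ i ]≔ just t) (vtx i) ≡ nothing
    settled {t} = trans (pending-vertices (p [ i ]≔ just t) i)
      (cong (maybe′ (λ _ → nothing) (just i)) (Vec.lookup∘update i p (just t)))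
    final : ∀ t {τ₂ τ₃} → Off 1 0 τ τ₂ → Ready (vtx i) (lookup g i) t τ₃ →
            Stamped jobs (vtx i) (λ U → bit (lookup g i xor (U ∙ t))) τ₂ τ₃ →
            Evolves jobs p τ (p [ i ]≔ just t) (write touchedA (evals τ₃ address) (1 % W) τ₃)
    final t {τ₂} {τ₃} off r st = sampled-evolves p≡ inv
      (λ { {us = us} dec →
        trans (write-array (evals τ₃ address) (1 % W) τ₃ (vtx i)
        (cell-≢ {0} {0} {3 + length us} {1} λ ())) (new st dec) })
      (write-at touchedA τ₃ (addressReady r) (bit-%W true))
      λ { a is a≢ a≢bit a≢run →
        trans (untouched a is a≢) (trans (old st a is (weaken a≢run)) (off a is (λ j _ → a≢bit j)))
        }
      where
      weaken : ∀ {a is} → (∀ c → a ≢ runA c 1) ⊎ is ≢ vtx i →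
        (∀ {c} → c ℕ.< length jobs → a ≢ runA c 1) ⊎ is ≢ vtx i
      weaken (inj₁ a≢)  = inj₁ λ {c} _ → a≢ c
      weaken (inj₂ is≢) = inj₂ is≢
      untouched : ∀ a is → a ≢ touchedA ⊎ is ≢ vtx i → write touchedA (evals τ₃ address) (1 % W) τ₃ a is ≡ τ₃ a is
      untouched a is (inj₁ a≢)  = write-array (evals τ₃ address) (1 % W) τ₃ is (a≢ ∘ sym)
      untouched a is (inj₂ is≢) =
        write-address touchedA (1 % W) τ₃ a (λ pf → is≢ (trans (sym pf) (addressReady r)))

  witness : ∀ (p : Partial D N) → ∃[ T ] T Extends p
  witness p = Always-witness (completions p) (completions-extend p) ,
              Always-witness-spec (completions p) (completions-extend p)

  -- Step-by-step simulation of one run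

  module Job {pfx U us} (split : jobs ≡ pfx ++ U ∷ us) where

    c : ℕ
    c = length us

    virt : Partial D N → Memory → Table D N → Memory
    virt = virtual c U

    -- The quantification over later states makes agreement stable.
    Agree : Expr → Partial D N → Memory → Set
    Agree e p τ = ∀ {p′ τ′} → Evolves jobs p τ p′ τ′ → ∀ {T} → T Extends p′ →
                  eval τ′ (rename c e) ≡ eval (virt p′ τ′ T) e

    Agrees : List Expr → Partial D N → Memory → Set
    Agrees es p τ = ∀ {p′ τ′} → Evolves jobs p τ p′ τ′ → ∀ {T} → T Extends p′ →
                    evals τ′ (renames c es) ≡ evals (virt p′ τ′ T) es

    Settled : ℕ → List Expr → Partial D N → Memory → Set
    Settled a es p τ = a ≡ 1 → pending p (evals τ (renames c es)) ≡ nothing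

    agree-evolves : ∀ {e p τ p′ τ′} → Agree e p τ → Evolves jobs p τ p′ τ′ → Agree e p′ τ′
    agree-evolves ag ev ev′ {T} = ag (evolves-trans ev ev′) {T}

    agrees-evolves : ∀ {es p τ p′ τ′} → Agrees es p τ → Evolves jobs p τ p′ τ′ → Agrees es p′ τ′
    agrees-evolves ag ev ev′ {T} = ag (evolves-trans ev ev′) {T}

    -- Neither side mentions a table, but the comparison passes through virtual memories. Any one
    -- completion can serve as the intermediary, and `witness` provides it.
    agrees-stable : ∀ {es p τ p′ τ′} → Invariant p τ → Agrees es p τ → Evolves jobs p τ p′ τ′ →
                    evals τ′ (renames c es) ≡ evals τ (renames c es)
    agrees-stable {es} {p} {τ} {p′} {τ′} inv ag ev with witness p′
    ... | T , ext = begin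
      evals τ′ (renames c es)      ≡⟨ ag ev {T} ext ⟩
      evals (virt p′ τ′ T) es      ≡⟨ evals-cong (preserves ev split {T} ext) es ⟩
      evals (virt p τ T) es        ≡⟨ ag (evolves-refl inv) {T} (extends ev {T} ext) ⟨
      evals τ (renames c es)       ∎
      where open ≡-Reasoning

    settled-evolves : ∀ {a es p τ p′ τ′} → Invariant p τ → Agrees es p τ → Evolves jobs p τ p′ τ′ →
                      (a ≡ 1 → pending p′ (evals τ (renames c es)) ≡ nothing) → Settled a es p′ τ′
    settled-evolves {es = es} {p′ = p′} inv ag ev st a≡ =
      trans (cong (pending p′) (agrees-stable {es} inv ag ev)) (st a≡)

    bounded-guard : ∀ a es {p τ R m} {h : Table D N → ℚ} → Invariant p τ →
      (∀ {p′ τ′} → Evolves jobs p τ p′ τ′ → (a ≡ 1 → pending p′ (evals τ (renames c es)) ≡ nothing) →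
        Bounded Φ m (R , τ′) (𝔼 (completions p′) h)) →
      Bounded Φ ((s + touchCost) + m) (guard c a es R , τ) (𝔼 (completions p) h)
    bounded-guard a es {p} {τ} {R} {m} {h} inv k = go (a ℕ.≟ 1) (length es ℕ.≟ s)
      where
      vs : List ℕ
      vs = evals τ (renames c es)
      length-vs : length vs ≡ length es
      length-vs = trans (length-evals τ (renames c es)) (length-renames c es)
      skip : ¬ (a ≡ 1 × length es ≡ s) → guard c a es R ≡ R
      skip ¬p rewrite dec-false ((a ℕ.≟ 1) ×-dec (length es ℕ.≟ s)) ¬p = refl
      enter : a ≡ 1 × length es ≡ s → guard c a es R ≡ load 0 (renames c es) (touch ∷ R)
      enter p rewrite dec-true ((a ℕ.≟ 1) ×-dec (length es ℕ.≟ s)) p = refl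
      skipped : ¬ (a ≡ 1 × length es ≡ s) → (a ≡ 1 → pending p vs ≡ nothing) →
                Bounded Φ ((s + touchCost) + m) (guard c a es R , τ) (𝔼 (completions p) h)
      skipped ¬p st = subst (λ K → Bounded Φ ((s + touchCost) + m) (K , τ) (𝔼 (completions p) h)) (sym (skip ¬p))
        (bounded-weaken (ℕ.m≤n+m m (s + touchCost)) (k (evolves-refl inv) st))
      go : Dec (a ≡ 1) → Dec (length es ≡ s) →
        Bounded Φ ((s + touchCost) + m) (guard c a es R , τ) (𝔼 (completions p) h)
      go (no a≢1)  _          = skipped (a≢1 ∘ proj₁) (λ a≡1 → contradiction a≡1 a≢1)
      go (yes a≡1) (no len≢)  =
        skipped (len≢ ∘ proj₂) (λ _ → pending-length p vs (λ pf → len≢ (trans (sym length-vs) pf)))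
      go (yes a≡1) (yes len≡) =
        subst (λ K → Bounded Φ ((s + touchCost) + m) (K , τ) (𝔼 (completions p) h))
        (sym (enter (a≡1 , len≡)))
        (bounded-cost (trans (cong (_+ (touchCost + m)) len≡) (sym (ℕ.+-assoc s touchCost m)))
          (bounded-load 0 c es λ {τ′} off vs≡ →
            let ev = off-evolves (inj₂ refl) off inv in
            bounded-touch (invariant ev)
              (trans (cong (λ l → evals τ′ (addrExprs 0 l)) (sym len≡)) vs≡) (trans length-vs len≡)
              λ ev′ st → k (evolves-trans ev ev′) (λ _ → st)))

    mutual
      bounded-pre : ∀ e {p τ R m} {h : Table D N → ℚ} → Invariant p τ →
        (∀ {p′ τ′} → Evolves jobs p τ p′ τ′ → Agree e p′ τ′ → Bounded Φ m (R , τ′) (𝔼 (completions p′) h)) →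
        Bounded Φ (preCost e + m) (pre c e R , τ) (𝔼 (completions p) h)
      bounded-pre (lit x)     inv k = k (evolves-refl inv) (λ _ _ → refl)
      bounded-pre (read a es) {R = R} {m} inv k =
        bounded-read a es {R = R} {m} inv λ {p′} {τ′} ev ag st → k ev λ {p″} {τ″} ev′ {T} ext →
        let st′ = settled-evolves {a} {es} (invariant ev) ag ev′ (λ a≡ → settles ev′ _ (st a≡)) in
        trans (sym (virtual-read c U p″ τ″ T a (evals τ″ (renames c es)) st′))
              (cong (virt p″ τ″ T a) (ag ev′ {T} ext))
      bounded-pre (op o d e)  {R = R} {m} inv k = bounded-cost (sym (ℕ.+-assoc (preCost d) (preCost e) m))
        (bounded-pre d inv λ ev ag → bounded-pre e (invariant ev) λ ev′ ag′ → k (evolves-trans ev ev′)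
          λ ev″ {T} ext → cong₂ (λ x y → ⟦ o ⟧ x y % W) (ag (evolves-trans ev′ ev″) {T} ext) (ag′ ev″ {T} ext))

      bounded-pres : ∀ es {p τ R m} {h : Table D N → ℚ} → Invariant p τ →
        (∀ {p′ τ′} → Evolves jobs p τ p′ τ′ → Agrees es p′ τ′ → Bounded Φ m (R , τ′) (𝔼 (completions p′) h)) →
        Bounded Φ (presCost es + m) (pres c es R , τ) (𝔼 (completions p) h)
      bounded-pres []       inv k = k (evolves-refl inv) (λ _ _ → refl)
      bounded-pres (e ∷ es) {R = R} {m} inv k = bounded-cost (sym (ℕ.+-assoc (preCost e) (presCost es) m))
        (bounded-pre e inv λ ev ag → bounded-pres es (invariant ev) λ ev′ ag′ → k (evolves-trans ev ev′)
          λ ev″ {T} ext → cong₂ _∷_ (ag (evolves-trans ev′ ev″) {T} ext) (ag′ ev″ {T} ext))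

      bounded-read : ∀ a es {p τ R m} {h : Table D N → ℚ} → Invariant p τ →
        (∀ {p′ τ′} → Evolves jobs p τ p′ τ′ → Agrees es p′ τ′ → Settled a es p′ τ′ →
          Bounded Φ m (R , τ′) (𝔼 (completions p′) h)) →
        Bounded Φ (preCost (read a es) + m) (pre c (read a es) R , τ) (𝔼 (completions p) h)
      bounded-read a es {R = R} {m} inv k = bounded-cost (sym (ℕ.+-assoc (presCost es) (s + touchCost) m))
        (bounded-pres es inv λ ev ag → bounded-guard a es (invariant ev) λ ev′ st →
          k (evolves-trans ev ev′) (agrees-evolves {es} ag ev′)
            (settled-evolves {a} {es} (invariant ev) ag ev′ st))

    split′ : jobs ≡ (pfx ++ U ∷ []) ++ us
    split′ = trans split (sym (List.++-assoc pfx (U ∷ []) us))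

    module _ (C t₀ : ℕ) (R : Code) (h : Table D N → ℕ → ℚ) where

      value : ℕ → Code → Table D N → Memory → ℚ
      value t K T σ = 𝔼 (run t (K , σ)) (λ d → h T (proj₂ d 2 []))

      -- Here `h` bounds the loss in the rest of the program, given the output of this run. It
      -- depends on `T` because later runs query the same table.
      values : ℕ → Code → Partial D N → Memory → ℚ
      values t K p τ = 𝔼 (completions p) (λ T → value t K T (virt p τ T))

      completions-cong : ∀ p {f f′ : Table D N → ℚ} → (∀ T → T Extends p → f T ≡ f′ T) →
                         𝔼 (completions p) f ≡ 𝔼 (completions p) f′
      completions-cong p = 𝔼-congᴬ (completions p) (completions-extend p)

      values-evolve : ∀ t K {p τ p′ τ′} → Evolves jobs p τ p′ τ′ →
                      values t K p′ τ′ ≡ 𝔼 (completions p′) (λ T → value t K T (virt p τ T))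
      values-evolve t K {p′ = p′} ev = completions-cong p′ λ T ext →
        𝔼-run-cong t K (h T) 2 [] (preserves ev split {T} ext)

      -- In `continue` only the later jobs `us` are preserved, since the run changes the virtual
      -- memory of its own channel.
      record Simulable (t : ℕ) (K : Code) (p : Partial D N) (τ : Memory) : Set where
        field
          valid    : Invariant p τ
          halting  : ∀ T → T Extends p → HaltsWithin t (K , virt p τ T)
          continue : ∀ {p′ τ′} → Evolves us p τ p′ τ′ →
                     Bounded Φ t₀ (R , τ′) (𝔼 (completions p′) (λ T → h T (τ′ (runA c 2) [])))

      open Simulable

      simulable-evolves : ∀ {t K p τ p′ τ′} → Simulable t K p τ → Evolves jobs p τ p′ τ′ → Simulable t K p′ τ′
      simulable-evolves {t} {K} sim ev = record
        { valid    = invariant ev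
        ; halting  = λ T ext →
          halts-cong t K (λ a is → sym (preserves ev split {T} ext a is))
          (halting sim T (extends ev {T} ext))
        ; continue = λ ev′ → continue sim (evolves-trans (evolves-suffix _ split′ ev) ev′)
        }

      simulable-write : ∀ {t K K′ t′ p τ} a is v {σ : Table D N → Memory} → Simulable t′ K′ p τ →
        (∀ T → T Extends p → virt p (write (runA c a) is v τ) T ≗ₘ σ T) →
        (∀ T → T Extends p → HaltsWithin t (K , σ T)) →
        Simulable t K p (write (runA c a) is v τ)
      simulable-write {t} {K} a is v sim same hlt = record
        { valid    = invariant ev
        ; halting  = λ T ext → halts-cong t K (λ b js → sym (same T ext b js)) (hlt T ext)
        ; continue = λ ev′ → continue sim (evolves-trans ev ev′)
        }
        where
        ev = write-evolves us a is v (valid sim)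

      stepped : ∀ t {c′ x X v} → x ≤ C → Bounded Φ (x + (t * C + t₀)) (X , c′) v →
        Bounded Φ (suc t * C + t₀) (X , c′) v
      stepped t {x = x} le b = bounded-weaken
        (subst (x + (t * C + t₀) ≤_) (sym (ℕ.+-assoc C (t * C) t₀)) (ℕ.+-monoˡ-≤ (t * C + t₀) le)) b

      reassoc : ∀ x y {z} → x + (y + suc z) ≡ x + (y + 1) + z
      reassoc x y {z} = trans (cong (x ℕ.+_) (sym (ℕ.+-assoc y 1 z))) (sym (ℕ.+-assoc x (y + 1) z))

      branch-within : ∀ m {P Q} → Within C P → Within C Q → Within C (branch m P Q)
      branch-within zero    wP wQ = wQ
      branch-within (suc _) wP wQ = wP

      compile-branch : ∀ m P Q K →
        branch m (compile c P []) (compile c Q []) ++ compile c K R ≡ compile c (branch m P Q ++ K) R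
      compile-branch zero    P Q K = trans (compile-++ c Q [] (compile c K R)) (sym (compile-append c Q K R))
      compile-branch (suc _) P Q K = trans (compile-++ c P [] (compile c K R)) (sym (compile-append c P K R))

      -- The `pre` that ends a compiled body is exactly the one that compilation puts in front of a
      -- loop. Hence the unrolled loop is literally the compilation of the body followed by the
      -- loop.
      compile-loop : ∀ e P →
        compile c P (pre c e []) ++ while (rename c e) (compile c P (pre c e [])) ∷ []
          ≡ compile c (P ++ while e P ∷ []) []
      compile-loop e P = trans (compile-++ c P (pre c e []) _)
        (trans (cong (compile c P) (pre-++ c e [] _)) (sym (compile-append c P (while e P ∷ []) [])))

      mutual
        -- Induction on the time of the virtual run. A round first samples the cells that the
        -- statement accesses, after which the translated statement acts in the same way on the
        -- virtual memories of all completions.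
        simulate : ∀ t K {p τ} → Within C K → Simulable t K p τ →
                   Bounded Φ (t * C + t₀) (compile c K R , τ) (values t K p τ)
        simulate t       []                    w       sim =
          bounded-weaken (ℕ.m≤n+m t₀ (t * C)) (continue sim (evolves-refl (valid sim)))
        -- The run has halted by now for every completion; one completion is enough to refute that
        -- statements remain.
        simulate zero    (S ∷ K) {p}           w       sim with witness p
        ... | T , ext with () ← halting sim T ext
        simulate (suc t) (assign a es e ∷ K)   (le , w) sim = stepped t le
          (bounded-cost (reassoc (preCost e) (preCost (read a es)))
            (bounded-pre e (valid sim) λ ev ag → bounded-read a es (invariant ev) λ ev′ ags st →
              let ev″ = evolves-trans ev ev′ in
              bounded-≡ (values-evolve (suc t) (assign a es e ∷ K) ev″)
                (simulate-assign t a es e K w (simulable-evolves sim ev″) (agree-evolves {e} ag ev′) ags st)))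
        simulate (suc t) (flip a es d e ∷ K)   (le , w) sim = stepped t le
          (bounded-cost
            (trans (cong (preCost d ℕ.+_) (reassoc (preCost e) (preCost (read a es))))
            (sym (ℕ.+-assoc (preCost d) _ _)))
            (bounded-pre d (valid sim) λ ev ag → bounded-pre e (invariant ev) λ ev′ ag′ →
              bounded-read a es (invariant ev′) λ ev″ ags st →
              let ev‴ = evolves-trans ev (evolves-trans ev′ ev″) in
              bounded-≡ (values-evolve (suc t) (flip a es d e ∷ K) ev‴)
                (simulate-flip t a es d e K w (simulable-evolves sim ev‴)
                  (agree-evolves {d} ag (evolves-trans ev′ ev″)) (agree-evolves {e} ag′ ev″) ags st)))
        simulate (suc t) (ifElse e P Q ∷ K)    ((le , wP , wQ) , w) sim = stepped t le
          (bounded-cost (sym (ℕ.+-assoc (preCost e) 1 _))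
            (bounded-pre e (valid sim) λ {p} {τ} ev ag →
              bounded-≡ (values-evolve (suc t) (ifElse e P Q ∷ K) ev)
                (simulate-jump t (ifElse e P Q) (branch (eval τ (rename c e)) P Q) K
                  (within-++ (branch (eval τ (rename c e)) P Q) (branch-within (eval τ (rename c e)) wP wQ) w)
                  (simulable-evolves sim ev)
                  (trans (step-ifElse (rename c e) _ _ (compile c K R) τ refl)
                    (cong (λ X → pure (X , τ)) (compile-branch (eval τ (rename c e)) P Q K)))
                  λ T ext → step-ifElse e P Q K (virt p τ T) (sym (ag (evolves-refl (invariant ev)) {T} ext)))))
        simulate (suc t) (while e P ∷ K)       ((le , wP) , w) sim = stepped t le
          (bounded-cost (sym (ℕ.+-assoc (preCost e) 1 _))
            (bounded-pre e (valid sim) λ {p} {τ} ev ag →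
              let m = eval τ (rename c e)
                  L = P ++ while e P ∷ [] in
              bounded-≡ (values-evolve (suc t) (while e P ∷ K) ev)
                (simulate-jump t (while e P) (branch m L []) K
                  (within-++ (branch m L []) (branch-within m (within-++ P wP ((le , wP) , tt)) tt) w)
                  (simulable-evolves sim ev)
                  (trans (step-while (rename c e) (compile c P (pre c e [])) (compile c K R) τ refl)
                    (cong (λ X → pure (X , τ)) (trans
                      (cong (λ X → branch m X [] ++ compile c K R) (compile-loop e P))
                      (compile-branch m L [] K))))
                  λ T ext → step-while e P K (virt p τ T) (sym (ag (evolves-refl (invariant ev)) {T} ext)))))

        simulate-assign : ∀ t a es e K {p τ} → Within C K → Simulable (suc t) (assign a es e ∷ K) p τ →
          Agree e p τ → Agrees es p τ → Settled a es p τ →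
          Bounded Φ (suc (t * C + t₀)) (assign (runA c a) (renames c es) (rename c e) ∷ compile c K R , τ)
            (values (suc t) (assign a es e ∷ K) p τ)
        simulate-assign t a es e K {p} {τ} w sim ag ags st =
          bounded-step refl (bounded-≡ (completions-cong p λ T ext → 𝔼-run-cong t K (h T) 2 [] (same T ext))
            (simulate t K w
              (simulable-write a (evals τ (renames c es)) (eval τ (rename c e)) sim same
              (halting sim))))
          where
          same : ∀ T → T Extends p →
                 virt p (write (runA c a) (evals τ (renames c es)) (eval τ (rename c e)) τ) T ≗ₘ
                 write a (evals (virt p τ T) es) (eval (virt p τ T) e) (virt p τ T)
          same T ext b js = trans (virtual-write c U p τ T a _ _ st b js)
            (write-cong₂ a {σ = virt p τ T} (ags (evolves-refl (valid sim)) {T} ext)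
              (ag (evolves-refl (valid sim)) {T} ext) (λ _ _ → refl) b js)

        simulate-flip : ∀ t a es d e K {p τ} → Within C K → Simulable (suc t) (flip a es d e ∷ K) p τ →
          Agree d p τ → Agree e p τ → Agrees es p τ → Settled a es p τ →
          Bounded Φ (suc (t * C + t₀))
            (flip (runA c a) (renames c es) (rename c d) (rename c e) ∷ compile c K R , τ)
            (values (suc t) (flip a es d e ∷ K) p τ)
        simulate-flip t a es d e K {p} {τ} w sim ag ag′ ags st = bounded-≡ veq (bounded-flip
          (simulate t K w
            (simulable-write a (evals τ (renames c es)) 1 sim (same 1)
            (λ T ext → proj₁ (halting sim T ext))))
          (simulate t K w
            (simulable-write a (evals τ (renames c es)) 0 sim (same 0)
            (λ T ext → proj₂ (halting sim T ext)))))
          where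
          x y : ℕ
          x = eval τ (rename c d)
          y = eval τ (rename c e)
          written : ℕ → Memory
          written v = write (runA c a) (evals τ (renames c es)) v τ
          same : ∀ v T → T Extends p →
                 virt p (written v) T ≗ₘ write a (evals (virt p τ T) es) v (virt p τ T)
          same v T ext b js = trans (virtual-write c U p τ T a _ _ st b js)
            (write-cong₂ a {σ = virt p τ T} (ags (evolves-refl (valid sim)) {T} ext) refl (λ _ _ → refl) b js)
          veq : bias x y ℚ.* values t K p (written 1) ℚ.+ bias y x ℚ.* values t K p (written 0)
                ≡ values (suc t) (flip a es d e ∷ K) p τ
          -- By agreement the virtual coin has the same weights `x` and `y` for every completion, so
          -- the mixture commutes with the expectation over completions.
          veq = trans (sym (𝔼-mix (completions p) (bias x y) (bias y x) _ _)) (completions-cong p λ T ext →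
            cong₂ ℚ._+_
              (cong₂ ℚ._*_
                (cong₂ bias (ag (evolves-refl (valid sim)) {T} ext)
                (ag′ (evolves-refl (valid sim)) {T} ext))
                           (𝔼-run-cong t K (h T) 2 [] (same 1 T ext)))
              (cong₂ ℚ._*_
                (cong₂ bias (ag′ (evolves-refl (valid sim)) {T} ext)
                (ag (evolves-refl (valid sim)) {T} ext))
                           (𝔼-run-cong t K (h T) 2 [] (same 0 T ext))))

        simulate-jump : ∀ t S L K {S′ p τ} → Within C (L ++ K) → Simulable (suc t) (S ∷ K) p τ →
          step S′ (compile c K R) τ ≡ pure (compile c (L ++ K) R , τ) →
          (∀ T → T Extends p → step S K (virt p τ T) ≡ pure (L ++ K , virt p τ T)) →
          Bounded Φ (suc (t * C + t₀)) (S′ ∷ compile c K R , τ) (values (suc t) (S ∷ K) p τ)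
        simulate-jump t S L K {S′} {p} {τ} w sim jump′ jump = bounded-step {S = S′} jump′ (bounded-≡
          (completions-cong p λ T ext → cong (λ d → 𝔼 (d >>= run t) (λ d → h T (proj₂ d 2 []))) (sym (jump T ext)))
          (simulate t (L ++ K) w record
            { valid    = valid sim
            ; halting  = λ T ext → subst (λ d → Always _ (d >>= run t)) (jump T ext) (halting sim T ext)
            ; continue = continue sim
            }))

-- The reduction

sumℚ : {A : Set} → (A → ℚ) → List A → ℚ
sumℚ f []       = 0ℚ
sumℚ f (x ∷ xs) = f x ℚ.+ sumℚ f xs

𝔼-sumℚ : ∀ {A B : Set} (d : Dist A) (f : B → A → ℚ) xs →
         𝔼 d (λ a → sumℚ (λ x → f x a) xs) ≡ sumℚ (λ x → 𝔼 d (f x)) xs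
𝔼-sumℚ d f []       = 𝔼-const d 0ℚ
𝔼-sumℚ d f (x ∷ xs) = trans (𝔼-+ d (f x) _) (cong (𝔼 d (f x) ℚ.+_) (𝔼-sumℚ d f xs))

sumℚ-≡ : ∀ {A : Set} {f : A → ℚ} {q} {xs} → All (λ x → f x ≡ q) xs → sumℚ f xs ≡ sumℚ (λ _ → q) xs
sumℚ-≡ []       = refl
sumℚ-≡ (p ∷ ps) = cong₂ ℚ._+_ p (sumℚ-≡ ps)

0≤n/m : ∀ n m .{{_ : NonZero m}} → 0ℚ ℚ.≤ + n / m
0≤n/m n m = ℚ.nonNegative⁻¹ (+ n / m) {{ℚ.normalize-nonNeg n m}}

sumℚ-const-≤ : ∀ {A : Set} {q} m .{{_ : NonZero m}} → q ℚ.≤ + 1 / m → (xs : List A) →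
               sumℚ (λ _ → q) xs ℚ.≤ + length xs / m
sumℚ-const-≤ m q≤ []       = 0≤n/m 0 m
sumℚ-const-≤ m q≤ (x ∷ xs) =
  ℚ.≤-trans (ℚ.+-mono-≤ q≤ (sumℚ-const-≤ m q≤ xs)) (ℚ.≤-reflexive (/-+ (+ 1) (+ length xs) m))

n/[3+3n]<1/3 : ∀ n → + n / (3 * suc n) ℚ.< + 1 / 3
n/[3+3n]<1/3 n = ℚ.toℚᵘ-cancel-< (ℚᵘ.<-respˡ-≃ (ℚᵘ.≃-sym (toℚᵘ-/ (+ n) (3 * suc n)))
  (ℚᵘ.<-respʳ-≃ (ℚᵘ.≃-sym (toℚᵘ-/ (+ 1) 3))
    (ℚᵘ.*<* (subst₂ ℤ._<_ (ℤ.pos-* n 3) (ℤ.pos-* 1 (3 * suc n)) (ℤ.+<+ lt′)))))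
  where
  lt′ : n * 3 ℕ.< 1 * (3 * suc n)
  lt′ = subst₂ ℕ._<_ (ℕ.*-comm 3 n) (sym (ℕ.*-identityˡ (3 * suc n))) (ℕ.*-monoʳ-< 3 (ℕ.n<1+n n))

wrong : ℕ → Bool → ℚ
wrong y b = 𝟙 (not (y ≡ᵇ bit b))

0≤𝟙 : ∀ b → 0ℚ ℚ.≤ 𝟙 b
0≤𝟙 true  = ℚ.nonNegative⁻¹ 1ℚ
0≤𝟙 false = ℚ.≤-refl

𝟙≤1 : ∀ b → 𝟙 b ℚ.≤ 1ℚ
𝟙≤1 true  = ℚ.≤-refl
𝟙≤1 false = ℚ.nonNegative⁻¹ 1ℚ

𝟙-∨ : ∀ {a} b c → (b ≡ false → c ≡ false → a ≡ false) → 𝟙 a ℚ.≤ 𝟙 b ℚ.+ 𝟙 c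
𝟙-∨ {a} true  c     imp = ℚ.≤-trans (𝟙≤1 a) (subst (ℚ._≤ 1ℚ ℚ.+ 𝟙 c) (ℚ.+-identityʳ 1ℚ) (ℚ.+-monoʳ-≤ 1ℚ (0≤𝟙 c)))
𝟙-∨ {a} false true  imp = ℚ.≤-trans (𝟙≤1 a) (ℚ.≤-reflexive (sym (ℚ.+-identityˡ 1ℚ)))
𝟙-∨     false false imp rewrite imp refl refl = ℚ.≤-refl

vanishing-parity : ∀ {n s} k → Vanishing (suc (2 ^ k)) (λ v → parity k (graph {n} {s} v))
vanishing-parity {n} {s} k =
  vanishing-xorSum (suc (2 ^ k)) (λ S v → cliqueᵇ (graph v) S) (choose n k) λ (S , ∣S∣≡k) →
  vanishing-≤ {F = λ v → cliqueᵇ (graph v) (S , ∣S∣≡k)}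
    (s≤s (subst (λ m → _ ≤ 2 ^ m) ∣S∣≡k (count-subsets n s S)))
    (vanishing-monomial ix (λ e → does (proj₁ e ⊆? S)) (choose n s))

initialMemory-cong : ∀ {n s} {G H : Hypergraph n s} → (∀ e → G e ≡ H e) → initialMemory G ≗ₘ initialMemory H
initialMemory-cong G≗H zero          []      = refl
initialMemory-cong G≗H zero          (_ ∷ _) = refl
initialMemory-cong G≗H (suc zero)    vs      = encode-cong G≗H vs
initialMemory-cong G≗H (suc (suc a)) vs      = refl

programTime : ∀ {A : Set} → ℕ → List A → ℕ
programTime t []       = 0
programTime t (_ ∷ us) = suc (t + suc (programTime t us))

module Reduction (s k D : ℕ) (jobs : List (Vec Bool D)) (n : ℕ) (g : Vec Bool (#edges n s))
                 (W : ℕ) {{W≢0 : NonZero W}} (1<W : 1 ℕ.< W) (K : Code) (tA : ℕ) where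

  F : Vec Bool (#edges n s) → Bool
  F v = parity k (graph {n} {s} v)

  loss : Memory → ℚ
  loss σ = wrong (σ 2 []) (F g)

  open Simulation s D jobs n g W {{W≢0}} 1<W loss public

  err : Vec Bool (#edges n s) → ℚ
  err x = 𝔼 (run tA (K , initialMemory (graph {n} {s} x))) (λ d → wrong (proj₂ d 2 []) (F x))

  -- The comparison fills in the size cell, which `program` copies only when the run starts.
  Fresh : List (Vec Bool D) → Partial D (#edges n s) → Memory → Set
  Fresh us p τ = ∀ {pfx U us′} → us ≡ pfx ++ U ∷ us′ → ∀ T → T Extends p →
    write 0 [] n (virtual (length us′) U p τ T) ≗ₘ initialMemory (graph {n} {s} (query g U T))

  fresh-evolves : ∀ {us p τ p′ τ′} → Fresh us p τ → Evolves us p τ p′ τ′ → Fresh us p′ τ′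
  fresh-evolves fr ev dec T ext a is =
    trans (write-cong 0 [] n (preserves ev dec {T} ext) a is) (fr dec T (extends ev {T} ext) a is)

  fresh-write : ∀ {us p τ} v → Fresh us p τ → Fresh us p (write 2 [] v τ)
  fresh-write {p = p} {τ} v fr {us′ = us′} dec T ext a is =
    trans (write-cong 0 [] n
      (virtual-cong (length us′) _ p T λ b js →
      write-array {2} {runA (length us′) b} [] v τ js λ ()) a is)
          (fr dec T ext a is)

  invariant-write : ∀ {p τ} v → Invariant p τ → Invariant p (write 2 [] v τ)
  invariant-write {τ = τ} v = invariant-cong
    (λ is → write-array {2} {0} [] v τ is λ ()) (λ is → write-array {2} {1} [] v τ is λ ())
    (λ is → write-array {2} {touchedA} [] v τ is λ ())

  -- What the accumulator must hold before the jobs `us` so that correct answers to them complete it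
  -- to `F g`.
  target : List (Vec Bool D) → Table D (#edges n s) → Bool
  target us T = F g xor xorSum (λ U → F (query g U T)) us

  -- The union bound as a potential: the loss for an accumulator that is off target, plus the error
  -- probabilities of the outstanding runs. It does not increase in expectation when a run is
  -- carried out.
  potential : List (Vec Bool D) → ℕ → Table D (#edges n s) → ℚ
  potential us y T = wrong y (target us T) ℚ.+ sumℚ (λ U → err (query g U T)) us

  -- An output that is not a bit counts as wrong, so only two correct bits have to be examined, and
  -- on these `xorℕ` is exact.
  wrong-xor : ∀ y z a b → wrong (xorℕ y z) (a xor b) ℚ.≤ wrong y a ℚ.+ wrong z b
  wrong-xor y z a b = 𝟙-∨ (not (y ≡ᵇ bit a)) (not (z ≡ᵇ bit b)) λ y≡ z≡ → lem (≡ᵇ-true y≡) (≡ᵇ-true z≡)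
    where
    ≡ᵇ-true : ∀ {m c} → not (m ≡ᵇ bit c) ≡ false → m ≡ bit c
    ≡ᵇ-true {m} {c} pf = ℕ.≡ᵇ⇒≡ m (bit c) (subst T (trans (cong not (sym pf)) (not-involutive _)) tt)
    lem : y ≡ bit a → z ≡ bit b → not (xorℕ y z ≡ᵇ bit (a xor b)) ≡ false
    lem refl refl rewrite xorℕ-bit a b = refl′ (a xor b)
      where
      refl′ : ∀ c → not (bit c ≡ᵇ bit c) ≡ false
      refl′ true  = refl
      refl′ false = refl

  module _ (halts : ∀ x → HaltsWithin tA (K , initialMemory (graph {n} {s} x))) where

    C : ℕ
    C = totalCost K

    -- The remaining jobs form the code `R` behind the current run, so the induction hypothesis
    -- enters `simulate` through `continue`.
    bounded-program : ∀ us pfx → jobs ≡ pfx ++ us → ∀ {p τ} → Invariant p τ → Fresh us p τ →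
      Bounded loss (programTime (tA * C) us) (program us K , τ) (𝔼 (completions p) (potential us (τ 2 [])))
    bounded-program [] pfx split {p} {τ} inv fr = bounded-≡ (sym (trans
      (𝔼-cong (completions p) (λ T → trans (ℚ.+-identityʳ _) (cong (wrong (τ 2 [])) (xor-identityʳ (F g)))))
      (𝔼-const (completions p) _))) bounded-done
    bounded-program (U ∷ us) pfx split {p} {τ} inv fr = bounded-step refl (bounded-≤ le
      (J.simulate C (suc (programTime (tA * C) us)) R h tA K (within K ℕ.≤-refl) record
        { valid    = invariant ev₁
        ; halting  = λ T ext → halts-cong tA K (λ a is → sym (starts T ext a is)) (halts (query g U T))
        ; continue = λ {p′} {τ′} ev → bounded-step refl (bounded-≡
            (cong (λ y → 𝔼 (completions p′) (potential us y)) (trans (write-same 2 [] _ τ′)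
               (trans (eval-xorExpr τ′ (read 2 []) (read (runA c 2) []))
                      (cong (λ y → xorℕ y (τ′ (runA c 2) [])) (trans (result ev) (result ev₁))))))
            (bounded-program us (pfx ++ U ∷ []) (trans split (sym (List.++-assoc pfx (U ∷ []) us)))
              (invariant-write _ (invariant ev)) (fresh-write {us} _ (fresh-evolves fresh₁ ev))))
        }))
      where
      module J = Job {pfx} {U} {us} split
      c : ℕ
      c = length us
      τ₁ : Memory
      τ₁ = write (runA c 0) [] (τ 0 []) τ
      R : Code
      R = assign 2 [] (xorExpr (read 2 []) (read (runA c 2) [])) ∷ program us K
      h : Table D (#edges n s) → ℕ → ℚ
      h T o = potential us (xorℕ (τ 2 []) o) T
      ev₁ : Evolves us p τ p τ₁
      ev₁ = write-evolves us 0 [] (τ 0 []) inv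
      fresh₁ : Fresh us p τ₁
      fresh₁ = fresh-evolves (λ { {pfx′} refl T ext → fr {U ∷ pfx′} refl T ext }) ev₁
      starts : ∀ T → T Extends p → virtual c U p τ₁ T ≗ₘ initialMemory (graph {n} {s} (query g U T))
      starts T ext a is = trans (virtual-write c U p τ T 0 [] (τ 0 []) (λ ()) a is)
        (trans (cong (λ v → write 0 [] v (virtual c U p τ T) a is) (size inv)) (fr {[]} refl T ext a is))
      le : J.values C (suc (programTime (tA * C) us)) R h tA K p τ₁
        ℚ.≤ 𝔼 (completions p) (potential (U ∷ us) (τ 2 []))
      le = 𝔼-monoᴬ (completions p) (completions-extend p) λ T ext →
        let x = query g U T
            rest = sumℚ (λ U → err (query g U T)) us
            d = run tA (K , initialMemory (graph {n} {s} x))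
            y = τ 2 []
            w = wrong y (target (U ∷ us) T)
            open ℚ.≤-Reasoning
        in begin
        𝔼 (run tA (K , virtual c U p τ₁ T)) (λ d → h T (proj₂ d 2 []))
          ≡⟨ 𝔼-run-cong tA K (h T) 2 [] (starts T ext) ⟩
        𝔼 d (λ c → wrong (xorℕ y (proj₂ c 2 [])) (target us T) ℚ.+ rest)
          ≤⟨ 𝔼-mono d (λ c → ℚ.+-monoˡ-≤ rest (subst (λ b → wrong (xorℕ y (proj₂ c 2 [])) b ℚ.≤ w ℚ.+ wrong (proj₂ c 2 []) (F x))
               (target-∷ U us T) (wrong-xor y (proj₂ c 2 []) (target (U ∷ us) T) (F x)))) ⟩
        𝔼 d (λ c → (w ℚ.+ wrong (proj₂ c 2 []) (F x)) ℚ.+ rest)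
          ≡⟨ 𝔼-+ d _ _ ⟩
        𝔼 d (λ c → w ℚ.+ wrong (proj₂ c 2 []) (F x)) ℚ.+ 𝔼 d (λ _ → rest)
          ≡⟨ cong₂ ℚ._+_ (trans (𝔼-+ d (λ _ → w) _) (cong (ℚ._+ err x) (𝔼-const d w))) (𝔼-const d rest) ⟩
        (w ℚ.+ err x) ℚ.+ rest
          ≡⟨ ℚ.+-assoc w (err x) rest ⟩
        potential (U ∷ us) y T ∎
        where
        target-∷ : ∀ U us T → target (U ∷ us) T xor F (query g U T) ≡ target us T
        target-∷ U us T = lem (F g) (F (query g U T)) _
          where
          lem : ∀ a b c → (a xor (b xor c)) xor b ≡ a xor c
          lem a b c = trans (xor-assoc a (b xor c) b) (cong (a xor_) (trans (xor-comm (b xor c) b)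
            (trans (sym (xor-assoc b b c)) (cong (_xor c) (xor-same b)))))

    blank : Partial D (#edges n s)
    blank = Vec.replicate (#edges n s) nothing

    module _ (G : Hypergraph n s) (G≗g : ∀ e → graph g e ≡ G e) where

      initial-invariant : Invariant blank (initialMemory G)
      initial-invariant = record
        { size    = refl
        ; input   = λ i →
          trans (encode-findEdge G (vtx i))
          (trans (cong (maybe′ (bit ∘ G ∘ edge) 0) (findEdge-vertices n s i))
                       (cong bit (trans (sym (G≗g (edge i))) (cong (lookup g) (ix-edge {n} {s} i)))))
        ; touched = λ i → cong (bit ∘ is-just) (sym (Vec.lookup-replicate i nothing))
        }

      initial-fresh : Fresh jobs blank (initialMemory G)
      initial-fresh {U = U} {us′} dec T ext zero          []      = refl
      initial-fresh {U = U} {us′} dec T ext zero          (_ ∷ _) = refl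
      initial-fresh {U = U} {us′} dec T ext (suc (suc a)) is      = refl
      initial-fresh {U = U} {us′} dec T ext (suc zero)    vs      =
        trans (lem (findEdge n s vs)) (sym (encode-findEdge (graph {n} {s} x) vs))
        where
        x = query g U T
        lem : ∀ m → inputCell (maybe′ (unsampled blank) nothing m) x 0 ≡ maybe′ (bit ∘ graph {n} {s} x ∘ edge) 0 m
        lem nothing  = refl
        lem (just i) rewrite Vec.lookup-replicate i (nothing {A = Vec Bool D}) =
          cong (bit ∘ lookup x) (sym (ix-edge {n} {s} i))

      bounded-start : Bounded loss (programTime (tA * C) jobs) (program jobs K , initialMemory G)
                        (𝔼 (completions blank) (potential jobs 0))
      bounded-start = bounded-program jobs [] refl initial-invariant initial-fresh

-- The corrected algorithm

𝟙-xorSum : ∀ {A : Set} (f : A → Bool) xs → 𝟙 (xorSum f xs) ℚ.≤ sumℚ (𝟙 ∘ f) xs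
𝟙-xorSum f []       = ℚ.≤-refl
𝟙-xorSum f (x ∷ xs) = ℚ.≤-trans (𝟙-∨ (f x) (xorSum f xs) (cong₂ _xor_)) (ℚ.+-monoʳ-≤ (𝟙 (f x)) (𝟙-xorSum f xs))

sumℚ-queries : ∀ {D N} (g : Vec Bool N) (h : Vec Bool N → ℚ) →
  𝔼 (completions (Vec.replicate N nothing)) (λ T → sumℚ (λ U → h (query g U T)) (nonzeros D))
  ≡ sumℚ (λ _ → 𝔼 (bits N) h) (nonzeros D)
sumℚ-queries {D} {N} g h =
  trans (𝔼-sumℚ (completions (Vec.replicate N nothing)) (λ U T → h (query g U T)) (nonzeros D))
  (sumℚ-≡ (All.map (λ {U} fU → 𝔼-query N {U} g fU h) (nonzeros-fair D)))

choose-> : ∀ {n k} → n ℕ.< k → choose n k ≡ []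
choose-> {zero}  {suc k} _         = refl
choose-> {suc n} {suc k} (s≤s n<k) rewrite choose-> n<k | choose-> (ℕ.m<n⇒m<1+n n<k) = refl

choose-self : ∀ k → ∃[ S ] choose k k ≡ S ∷ []
choose-self zero = _ , refl
choose-self (suc k) with choose-self k
... | S , pf rewrite pf | choose-> (ℕ.n<1+n k) = _ , refl

parity-complete : ∀ {s} k {G : Hypergraph k s} → (∀ e → G e ≡ true) → parity k G ≡ true
parity-complete {s} k {G} complete with choose-self k
... | S , pf rewrite pf = trans (xor-identityʳ (cliqueᵇ G S)) (trans
  (allᵇ-cong (λ e → trans (cong (_ ∨_) (complete e)) (∨-zeroʳ _)) (choose k s)) (allᵇ-true (choose k s)))
  where
  allᵇ-true : ∀ {A : Set} (xs : List A) → allᵇ (λ _ → true) xs ≡ true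
  allᵇ-true []       = refl
  allᵇ-true (x ∷ xs) = allᵇ-true xs

programTime-mono : ∀ {A : Set} {t t′} (us : List A) → t ≤ t′ → programTime t us ≤ programTime t′ us
programTime-mono []       le = z≤n
programTime-mono (_ ∷ us) le = s≤s (ℕ.+-mono-≤ le (s≤s (programTime-mono us le)))

-- The 2 stands for the two assignments around each run, which are charged to the time `t ≥ 1`.
programTime-≤ : ∀ {A : Set} t C (us : List A) → 1 ≤ t → programTime (t * C) us ≤ length us * (2 + C) * t
programTime-≤ t C []       1≤t = z≤n
programTime-≤ t C (_ ∷ us) 1≤t = begin
  suc (t * C + suc (programTime (t * C) us))      ≡⟨ cong suc (ℕ.+-suc (t * C) _) ⟩
  2 + (t * C + programTime (t * C) us)            ≡⟨ ℕ.+-assoc 2 (t * C) _ ⟨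
  (2 + t * C) + programTime (t * C) us
    ≤⟨ ℕ.+-mono-≤ (ℕ.+-mono-≤ (ℕ.*-monoʳ-≤ 2 1≤t) (ℕ.≤-reflexive (ℕ.*-comm t C))) (programTime-≤ t C us 1≤t) ⟩
  (2 * t + C * t) + length us * (2 + C) * t       ≡⟨ cong (_+ length us * (2 + C) * t) (ℕ.*-distribʳ-+ t 2 C) ⟨
  (2 + C) * t + length us * (2 + C) * t           ≡⟨ ℕ.*-distribʳ-+ t (2 + C) (length us * (2 + C)) ⟨
  (2 + C + length us * (2 + C)) * t               ∎
  where open ℕ.≤-Reasoning

1<wordBound : ∀ κ n → 1 ℕ.< wordBound κ n
1<wordBound κ n = ℕ.*-mono-≤ {2} {2 + n} {1} (s≤s (s≤s z≤n)) (ℕ.m^n>0 (2 + n) κ)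

-- Error probabilities as expectations

Pr-errs : ∀ {s} k (A : Algorithm s) n (G : Hypergraph n s) →
  Pr (errs k A n G) ≡
  𝔼 (Machine.run (Algorithm.κ A) n (time A n) (Algorithm.start A G)) (λ c → wrong (proj₂ c 2 []) (parity k G))
Pr-errs k A n G = begin
  Pr (errs k A n G)                         ≡⟨ Pr≡𝔼 (errs k A n G) ⟩
  𝔼 (errs k A n G) 𝟙                        ≡⟨ 𝔼->>= (Algorithm.output A n G) _ 𝟙 ⟩
  𝔼 (Algorithm.output A n G) (λ out → 𝟙 (not (out ≡ᵇ cliqueParity k G)))
                                            ≡⟨ 𝔼->>= (Machine.run κ n (time A n) (Algorithm.start A G)) _ _ ⟩
  𝔼 (Machine.run κ n (time A n) (Algorithm.start A G)) (λ c → 𝟙 (not (proj₂ c 2 [] ≡ᵇ cliqueParity k G)))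
    ≡⟨ cong (λ m → 𝔼 (Machine.run κ n (time A n) (Algorithm.start A G)) (λ c → 𝟙 (not (proj₂ c 2 [] ≡ᵇ m))))
            (cliqueParity-parity k G) ⟩
  𝔼 (Machine.run κ n (time A n) (Algorithm.start A G)) (λ c → wrong (proj₂ c 2 []) (parity k G)) ∎
  where
  open ≡-Reasoning
  κ = Algorithm.κ A

Pr-errs-cong : ∀ {s} k (A : Algorithm s) n {G H : Hypergraph n s} → (∀ e → G e ≡ H e) →
               Pr (errs k A n G) ≡ Pr (errs k A n H)
Pr-errs-cong k A n {G} {H} G≗H = begin
  Pr (errs k A n G)  ≡⟨ Pr-errs k A n G ⟩
  𝔼 (run (time A n) (code , initialMemory G)) (λ c → wrong (proj₂ c 2 []) (parity k G))
    ≡⟨ cong (λ b → 𝔼 (run (time A n) (code , initialMemory G)) (λ c → wrong (proj₂ c 2 []) b)) (parity-cong k G≗H) ⟩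
  𝔼 (run (time A n) (code , initialMemory G)) (λ c → wrong (proj₂ c 2 []) (parity k H))
    ≡⟨ 𝔼-run-cong (time A n) code (λ m → wrong m (parity k H)) 2 [] (initialMemory-cong G≗H) ⟩
  𝔼 (run (time A n) (code , initialMemory H)) (λ c → wrong (proj₂ c 2 []) (parity k H))
    ≡⟨ Pr-errs k A n H ⟨
  Pr (errs k A n H) ∎
  where
  open ≡-Reasoning
  open Algorithm A using (κ; code)
  open Run (wordBound κ n) {{ℕ.m^n≢0 (2 + n) (suc κ)}}

averageError : ∀ {s} → ℕ → Algorithm s → ℕ → ℚ
averageError {s} k A n = 𝔼 (bits (#edges n s)) (λ v → Pr (errs k A n (graph v)))

averageError-Pr : ∀ {s} k (A : Algorithm s) n → averageError k A n ≡ Pr (randomHypergraph n s >>= errs k A n)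
averageError-Pr {s} k A n = begin
  averageError k A n
    ≡⟨ 𝔼-randomHypergraph n s (λ G → Pr (errs k A n G)) (Pr-errs-cong k A n) ⟨
  𝔼 (randomHypergraph n s) (λ G → Pr (errs k A n G))
    ≡⟨ 𝔼-cong (randomHypergraph n s) (λ G → Pr≡𝔼 (errs k A n G)) ⟩
  𝔼 (randomHypergraph n s) (λ G → 𝔼 (errs k A n G) 𝟙)
    ≡⟨ 𝔼->>= (randomHypergraph n s) (errs k A n) 𝟙 ⟨
  𝔼 (randomHypergraph n s >>= errs k A n) 𝟙
    ≡⟨ Pr≡𝔼 (randomHypergraph n s >>= errs k A n) ⟨
  Pr (randomHypergraph n s >>= errs k A n) ∎
  where open ≡-Reasoning

module _ (s k : ℕ) where

  private
    D : ℕ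
    D = suc (2 ^ k)

    jobs : List (Vec Bool D)
    jobs = nonzeros D

  module _ (A : Algorithm s) where

    open Algorithm A using (code; κ; halts)

    module Correction n (g : Vec Bool (#edges n s)) =
      Reduction s k D jobs n g (wordBound κ n) {{ℕ.m^n≢0 (2 + n) (suc κ)}} (1<wordBound κ n) code (time A n)

    open Compile s D jobs using (totalCost; program)

    correctedTime : ℕ → ℕ
    correctedTime n = programTime (time A n * totalCost code) jobs

    corrected : Algorithm s
    corrected = record
      { code      = program jobs code
      ; κ         = κ
      ; time      = correctedTime
      ; time-mono = λ m≤n → programTime-mono jobs (ℕ.*-monoˡ-≤ (totalCost code) (Algorithm.time-mono A m≤n))
      ; halts     = λ n G →
        Correction.halted {n} {vector G}
        (Correction.bounded-start n (vector G) (λ x → halts n (graph x)) G (graph-vector G))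
      }

    corrected-error : ∀ n G → Pr (errs k corrected n G) ℚ.≤ sumℚ (λ _ → averageError k A n) jobs
    corrected-error n G = begin
      Pr (errs k corrected n G)
        ≡⟨ Pr-errs k corrected n G ⟩
      𝔼 (run (correctedTime n) (program jobs code , initialMemory G)) (λ c → wrong (proj₂ c 2 []) (parity k G))
        ≡⟨ cong (λ b → 𝔼 (run (correctedTime n) (program jobs code , initialMemory G)) (λ c → wrong (proj₂ c 2 []) b))
                (parity-cong k (graph-vector G)) ⟨
      𝔼 (run (correctedTime n) (program jobs code , initialMemory G)) (loss ∘ proj₂)
        ≤⟨ bound (bounded-start halts′ G (graph-vector G)) ⟩
      𝔼 (completions (blank halts′)) (potential jobs 0)
        -- By self-correction the initial accumulator 0 is on target for every table, which leaves
        -- only the error terms.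
        ≡⟨ 𝔼-cong (completions (blank halts′)) (λ T → trans (cong (λ b → 𝟙 (not (0 ≡ᵇ bit b)) ℚ.+ total T) (correct T)) (ℚ.+-identityˡ (total T))) ⟩
      𝔼 (completions (blank halts′)) total
        ≡⟨ sumℚ-queries g err ⟩
      sumℚ (λ _ → 𝔼 (bits (#edges n s)) err) jobs
        ≡⟨ cong (λ q → sumℚ (λ _ → q) jobs) (𝔼-cong (bits (#edges n s)) (λ v → Pr-errs k A n (graph v))) ⟨
      sumℚ (λ _ → averageError k A n) jobs ∎
      where
      open ℚ.≤-Reasoning
      g : Vec Bool (#edges n s)
      g = vector G
      open Correction n g hiding (program; totalCost)
      halts′ : ∀ x → HaltsWithin (time A n) (code , initialMemory (graph {n} {s} x))
      halts′ x = halts n (graph x)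
      total : Table D (#edges n s) → ℚ
      total T = sumℚ (λ U → err (query g U T)) jobs
      correct : ∀ T → target jobs T ≡ false
      correct T = trans
        (cong (_xor xorSum (λ U → F (query g U T)) jobs)
        (self-correction D {F} (vanishing-parity {n} {s} k) g T))
        (xor-same (xorSum (λ U → F (query g U T)) jobs))

    idle-error : ∀ n → code ≡ [] →
      averageError k A n ≡ 𝔼 (bits (#edges n s)) (λ v → 𝟙 (parity k (graph {n} {s} v)))
    idle-error n code≡[] = 𝔼-cong (bits (#edges n s)) λ v → trans (Pr-errs k A n (graph v)) (lem v code≡[])
      where
      lem : ∀ v {c} → c ≡ [] → 𝔼 (Machine.run κ n (time A n) (c , initialMemory (graph {n} {s} v)))
              (λ d → wrong (proj₂ d 2 []) (parity k (graph {n} {s} v))) ≡ 𝟙 (parity k (graph {n} {s} v))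
      lem v refl with parity k (graph {n} {s} v)
      ... | true  = refl
      ... | false = refl

    -- Empty code answers 0 and errs exactly on inputs of odd parity. The complete hypergraph on `k`
    -- vertices has odd parity, so by self-correction every table gives at least one query of odd
    -- parity.
    idle-bound : code ≡ [] → 1ℚ ℚ.≤ sumℚ (λ _ → averageError k A k) jobs
    idle-bound code≡[] = begin
      1ℚ                                        ≡⟨ cong 𝟙 odd ⟨
      𝟙 (F g)                                   ≡⟨ 𝔼-const (completions (Vec.replicate (#edges k s) nothing)) (𝟙 (F g)) ⟨
      𝔼 (completions (Vec.replicate (#edges k s) nothing)) (λ _ → 𝟙 (F g))
        ≤⟨ 𝔼-mono (completions (Vec.replicate (#edges k s) nothing)) (λ T → subst (λ b → 𝟙 b ℚ.≤ sumℚ (λ U → 𝟙 (F (query g U T))) jobs)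
             (sym (self-correction D {F} (vanishing-parity {k} {s} k) g T))
               (𝟙-xorSum (λ U → F (query g U T)) jobs)) ⟩
      𝔼 (completions (Vec.replicate (#edges k s) nothing)) (λ T → sumℚ (λ U → 𝟙 (F (query g U T))) jobs)
        ≡⟨ sumℚ-queries g (𝟙 ∘ F) ⟩
      sumℚ (λ _ → 𝔼 (bits (#edges k s)) (𝟙 ∘ F)) jobs
        ≡⟨ cong (λ q → sumℚ (λ _ → q) jobs) (idle-error k code≡[]) ⟨
      sumℚ (λ _ → averageError k A k) jobs ∎
      where
      open ℚ.≤-Reasoning
      F : Vec Bool (#edges k s) → Bool
      F v = parity k (graph {k} {s} v)
      g : Vec Bool (#edges k s)
      g = Vec.replicate (#edges k s) true
      odd : F g ≡ true
      odd = parity-complete k (λ e → Vec.lookup-replicate (ix e) true)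

  -- The successor keeps the total error strictly below 1/3 although `sumℚ-const-≤` is not strict.
  ε : ℚ
  ε = + 1 / (3 * suc (length jobs))

  0<ε : 0ℚ ℚ.< ε
  0<ε = ℚ.positive⁻¹ ε {{ℚ.normalize-pos 1 (3 * suc (length jobs))}}

  averageError-sum : ∀ (A : Algorithm s) → averageErrorBelow ε k A → ∀ n →
    sumℚ (λ _ → averageError k A n) jobs ℚ.< + 1 / 3
  averageError-sum A below n = ℚ.≤-<-trans
    (sumℚ-const-≤ (3 * suc (length jobs)) (subst (ℚ._≤ ε) (sym (averageError-Pr k A n)) (ℚ.<⇒≤ (below n))) jobs)
    (n/[3+3n]<1/3 (length jobs))

  halts-at-once : ∀ (A : Algorithm s) n → time A n ≡ 0 → Algorithm.code A ≡ []
  halts-at-once A n t≡0 = lem (Algorithm.code A)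
    (subst (λ t → Machine.HaltsWithin (Algorithm.κ A) n t (Algorithm.start A empty)) t≡0
      (Algorithm.halts A n empty))
    where
    empty : Hypergraph n s
    empty _ = false
    lem : ∀ c → Machine.HaltsWithin (Algorithm.κ A) n 0 (c , initialMemory empty) → c ≡ []
    lem []      p = refl
    lem (_ ∷ _) p = p

  -- The code is common to all sizes: if it is empty because of time 0 at size `n`, the
  -- contradiction can be drawn at size `k`.
  time-positive : ∀ (A : Algorithm s) → averageErrorBelow ε k A → ∀ n → 1 ≤ time A n
  time-positive A below n = ℕ.n≢0⇒n>0 λ t≡0 → ℚ.<-irrefl refl
    (ℚ.<-trans (ℚ.≤-<-trans (idle-bound A (halts-at-once A n t≡0)) (averageError-sum A below k)) 1/3<1)
    where
    1/3<1 : + 1 / 3 ℚ.< 1ℚ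
    1/3<1 = ℚ.*<* (ℤ.+<+ (s≤s (s≤s z≤n)))

  -- The overhead `M` depends on `s`, `k` and the code of A but not on `n`, so it only enlarges the
  -- constant and leaves the exponent as it is.
  lowerBound : ∀ a b (A : Algorithm s) → averageErrorBelow ε k A →
               LowerBound a b k (time (corrected A)) → LowerBound a b k (time A)
  lowerBound a b A below (c , n₀ , lb) = c * M , n₀ , λ n n₀≤n → ℕ.≤-trans (lb n n₀≤n) (ℕ.^-monoˡ-≤ b
    (subst (c * correctedTime A n ≤_) (sym (ℕ.*-assoc c M (time A n)))
      (ℕ.*-monoʳ-≤ c (programTime-≤ (time A n) C jobs (time-positive A below n)))))
    where
    C M : ℕ
    C = Compile.totalCost s D jobs (Algorithm.code A)
    M = length jobs * (2 + C)

corollary2p12 : ∀ (s k : ℕ) → 2 ≤ s → s ≤ k →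
    Σ[ ε ∈ ℚ ] 0ℚ < ε ×
    (∀ (a b : ℕ) .{{_ : NonZero a}} .{{_ : NonZero b}} →
    (∀ (B : Algorithm s) → worstCaseErrorBelow (+ 1 / 3) k B → LowerBound a b k (time B)) →
    (∀ (A : Algorithm s) → averageErrorBelow ε k A → LowerBound a b k (time A)))
corollary2p12 s k _ _ = ε s k , 0<ε s k , λ a b hardness A below →
  lowerBound s k a b A below (hardness (corrected s k A) λ n G →
    ℚ.≤-<-trans (corrected-error s k A n G) (averageError-sum s k A below n))
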